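{- Let $G$ be a nontrivial connected graph and let $n\geq 5$ be an integer. If $n(n-1)\lambda'(G)>(n-1)\xi(G)+2(n-2)$, then the direct product $G\times K_n$ is super restricted edge-connected (super-$\lambda'$).
   Context: $G$ is a finite simple graph; it is nontrivial if it has at least two vertices. $K_n$ is the complete graph on $n$ vertices. For an edge $uv\in E(G)$ its edge-degree is $d_G(u)+d_G(v)-2$, and the minimum edge-degree is $\xi(G)=\min\{d_G(u)+d_G(v)-2: uv\in E(G)\}$. For a graph $H$, an edge subset $F\subseteq E(H)$ is an edge-cut if $H-F$ (delete the edges in $F$, keep all vertices) is disconnected. A restricted edge-cut of $H$ is an edge-cut $F$ such that every component of $H-F$ has at least two vertices (equivalently, $H-F$ is disconnected and has no isolated vertices). The restricted edge-connectivity $\lambda'(H)$ is the cardinality of a minimum (i.e. smallest-cardinality) restricted edge-cut of $H$ if $H$ has a restricted edge-cut, and $\lambda'(H)=+\infty$ otherwise (so an inequality $n(n-1)\lambda'(G)>c$ with finite $c$ holds when $\lambda'(G)=+\infty$). $H$ is super restricted edge-connected (super-$\lambda'$) if every minimum restricted edge-cut $F$ of $H$ isolates an edge from $H$, i.e. some component of $H-F$ consists of exactly two vertices joined by an edge. The direct product $G_1\times G_2$ has vertex set $V(G_1)\times V(G_2)$, with $(u_1,v_1)$ adjacent to $(u_2,v_2)$ if and only if $u_1u_2\in E(G_1)$ and $v_1v_2\in E(G_2)$. -}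

module Defs where

open import Data.Fin.Base using (Fin) renaming (_<_ to _<ᶠ_)
open import Data.Fin.Properties using (*↔×) renaming (_<?_ to _<ᶠ?_; _≟_ to _≟ᶠ_)
open import Data.List.Base using (List; allFin; cartesianProduct; filter; length; map)
open import Data.Nat.Base using (ℕ; _+_; _*_; _∸_; _≤_; _<_)
open import Data.Product.Base using (∃; ∃₂; _×_; _,_)
open import Data.Product.Function.NonDependent.Propositional using (_×-↔_)
open import Function.Base using (_∘_)
open import Function.Bundles using (_↔_; Inverse)
open import Function.Construct.Composition using (_↔-∘_)
open import Function.Construct.Identity using (↔-id)
open import Function.Construct.Symmetry using (↔-sym)
open import Level using (0ℓ)
open import Relation.Binary.Construct.Closure.ReflexiveTransitive using (Star)
open import Relation.Binary.Core using (Rel; _⇒_)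
open import Relation.Binary.Definitions using (Decidable; Irreflexive; Symmetric)
open import Relation.Binary.PropositionalEquality.Core using (_≡_; _≢_; ≢-sym)
open import Relation.Nullary.Construct.Add.Supremum using (_⁺; ⊤⁺; [_])
open import Relation.Nullary.Decidable using (_×-dec_; ¬?)
open import Relation.Nullary.Negation.Core using (¬_)
open import Relation.Unary using (Pred; _≐_; _∪_; ｛_｝) renaming (_∈_ to _∈ᵖ_)

-- The enumeration of the vertices makes the graph finite; the order it induces
-- serves only to count vertices and edges.

record Graph : Set₁ where
  field
    V      : Set
    order  : ℕ
    enum   : V ↔ Fin order
    Adj    : Rel V 0ℓ
    adj?   : Decidable Adj
    sym    : Symmetric Adj
    irrefl : Irreflexive _≡_ Adj

  vertex : Fin order → V
  vertex = Inverse.from enum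

  vertices : List V
  vertices = map vertex (allFin order)

  degree : V → ℕ
  degree u = length (filter (adj? u) vertices)

  -- Only used when u and v are adjacent; both degrees are then positive,
  -- so the subtraction does not truncate.
  edgeDegree : V → V → ℕ
  edgeDegree u v = degree u + degree v ∸ 2

  Component : V → Pred V 0ℓ
  Component v = Star Adj v

  Connected : Set
  Connected = ∀ u v → Star Adj u v

  Nontrivial : Set
  Nontrivial = 2 ≤ order

open Graph using (V; Adj; Component; Connected; order; vertex)

K : ℕ → Graph
K n = record
  { V      = Fin n
  ; order  = n
  ; enum   = ↔-id (Fin n)
  ; Adj    = _≢_
  ; adj?   = λ i j → ¬? (i ≟ᶠ j)
  ; sym    = ≢-sym
  ; irrefl = λ i≡j i≢j → i≢j i≡j
  }

infixr 7 _⊗_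

_⊗_ : Graph → Graph → Graph
G ⊗ H = record
  { V      = G.V × H.V
  ; order  = G.order * H.order
  ; enum   = ↔-sym *↔× ↔-∘ (G.enum ×-↔ H.enum)
  ; Adj    = λ (u₁ , v₁) (u₂ , v₂) → G.Adj u₁ u₂ × H.Adj v₁ v₂
  ; adj?   = λ (u₁ , v₁) (u₂ , v₂) → G.adj? u₁ u₂ ×-dec H.adj? v₁ v₂
  ; sym    = λ (a , b) → G.sym a , H.sym b
  ; irrefl = λ { _≡_.refl (a , _) → G.irrefl _≡_.refl a }
  }
  where
  module G = Graph G
  module H = Graph H

Isξ : Graph → ℕ → Set
Isξ G k = (∃₂ λ u v → G.Adj u v × G.edgeDegree u v ≡ k)
        × (∀ u v → G.Adj u v → k ≤ G.edgeDegree u v)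
  where module G = Graph G

-- A set of edges, as a symmetric relation contained in adjacency.

record EdgeSet (H : Graph) : Set₁ where
  field
    In   : Rel (V H) 0ℓ
    in?  : Decidable In
    sym  : Symmetric In
    ⊆Adj : In ⇒ Adj H

  -- Each edge is counted once, with its endpoints in increasing order.
  ∣_∣ : ℕ
  ∣_∣ = length (filter (λ (i , j) → (i <ᶠ? j) ×-dec in? (vertex H i) (vertex H j))
                       (cartesianProduct (allFin (order H)) (allFin (order H))))

open EdgeSet using (∣_∣)

infixl 6 _─_

_─_ : (H : Graph) → EdgeSet H → Graph
H ─ F = record
  { V      = H.V
  ; order  = H.order
  ; enum   = H.enum
  ; Adj    = λ u v → H.Adj u v × ¬ F.In u v
  ; adj?   = λ u v → H.adj? u v ×-dec ¬? (F.in? u v)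
  ; sym    = λ (a , ∉F) → H.sym a , ∉F ∘ F.sym
  ; irrefl = λ eq (a , _) → H.irrefl eq a
  }
  where
  module H = Graph H
  module F = EdgeSet F

module _ (H : Graph) where

  IsEdgeCut : EdgeSet H → Set
  IsEdgeCut F = ¬ Connected (H ─ F)

  IsRestrictedEdgeCut : EdgeSet H → Set
  IsRestrictedEdgeCut F =
    IsEdgeCut F ×
    (∀ r → ∃₂ λ u v → u ∈ᵖ Component (H ─ F) r × v ∈ᵖ Component (H ─ F) r × u ≢ v)

  IsMinRestrictedEdgeCut : EdgeSet H → Set₁
  IsMinRestrictedEdgeCut F =
    IsRestrictedEdgeCut F × (∀ F′ → IsRestrictedEdgeCut F′ → ∣ F ∣ ≤ ∣ F′ ∣)

  -- ℕ ⁺ is ℕ with a top element ⊤⁺, standing for +∞.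
  Isλ′ : ℕ ⁺ → Set₁
  Isλ′ [ k ] = ∃ λ F → IsMinRestrictedEdgeCut F × ∣ F ∣ ≡ k
  Isλ′ ⊤⁺    = ∀ F → ¬ IsRestrictedEdgeCut F

  IsolatesEdge : EdgeSet H → Set
  IsolatesEdge F = ∃ λ r → ∃₂ λ u v →
    Adj (H ─ F) u v × Component (H ─ F) r ≐ ｛ u ｝ ∪ ｛ v ｝

  Superλ′ : Set₁
  Superλ′ = ∀ F → IsMinRestrictedEdgeCut F → IsolatesEdge F

-- Scaling by c on ℕ ∪ {+∞}, for positive c (0 · ∞ is ∞ here).
infixr 7 _*⁺_

_*⁺_ : ℕ → ℕ ⁺ → ℕ ⁺
c *⁺ [ k ] = [ c * k ]
c *⁺ ⊤⁺    = ⊤⁺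

open import Relation.Binary.Construct.Add.Supremum.Strict _<_ public using (_<⁺_)

{-# OPTIONS --safe #-}

-- Write H = G × Kₙ, call {p} × Kₙ the fibre of p, and let F be a minimum restricted
-- edge-cut of H. Cutting off an edge of H of minimum edge-degree shows
-- |F| ≤ M := (n-1) ξ(G) + 2 (n-2). Let X be a component of H - F; a fibre is mixed if it
-- meets both X and its complement, and pure otherwise.
--
-- Between a mixed fibre and any adjacent fibre F has at least n-1 edges, and at least 2 (n-2)
-- between two adjacent mixed fibres. Summing over the edges of G at u or w shows that |F| ≥ M
-- when u and w are adjacent and mixed; equality forces X (or its complement) to meet the two
-- fibres in the two ends of an edge, which is then isolated by F. Otherwise mixed fibres are
-- pairwise nonadjacent. The same summation gives |F| > M if some pure fibre next to a mixed
-- one has no neighbouring pure fibre on its own side. If this does not happen either, every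
-- slice {p : (p , i) ∈ X} defines a restricted edge-cut Dᵢ of G, and
-- n (n-1) λ′(G) ≤ (n-1) Σᵢ |Dᵢ| ≤ |F| ≤ M, against the hypothesis.

module Submission where

open import Defs
open import Data.Bool.Base using (Bool; true; false; if_then_else_; not; _∨_)
import Data.Bool.Properties as Bool
open import Data.Bool.Properties using (not-¬; ¬-not; ∨-zeroʳ)
open import Data.Empty using (⊥; ⊥-elim)
open import Data.Fin.Base using (Fin; zero; suc; combine; _↑ˡ_; _↑ʳ_) renaming (_<_ to _<ᶠ_)
open import Data.Fin.Patterns
open import Data.Fin.Properties using (remQuot-combine; <-cmp; any?; all?; suc-injective)
  renaming (_<?_ to _<ᶠ?_; _≟_ to _≟ᶠ_)
open import Data.List.Base using (cartesianProduct; filter; length; map; tabulate; _++_)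
open import Data.List.Properties using (map-tabulate; filter-++; length-++)
open import Data.Nat.Base
  using (ℕ; zero; suc; pred; _+_; _*_; _∸_; _≤_; _<_; z≤n; s≤s; s≤s⁻¹; >-nonZero)
open import Data.Nat.Properties hiding (suc-injective; <-cmp; _≟_)
open import Data.Nat.Tactic.RingSolver using (solve-∀)
open import Data.Product.Base using (∃; _×_; _,_; proj₁; proj₂)
open import Data.Sum.Base using (_⊎_; inj₁; inj₂)
open import Data.Unit.Base using (tt)
open import Function.Base using (_∘_; id)
open import Function.Bundles using (Inverse)
open import Level using (0ℓ)
open import Relation.Binary.Construct.Add.Supremum.Strict _<_ using ([<]-injective)
open import Relation.Binary.Construct.Closure.ReflexiveTransitive using (Star; ε; _◅_; _◅◅_)
open import Relation.Binary.Definitions using (tri<; tri≈; tri>; DecidableEquality)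
open import Relation.Binary.PropositionalEquality
open import Relation.Nullary
open import Relation.Nullary.Construct.Add.Supremum using (_⁺; ⊤⁺; [_])
open import Relation.Nullary.Decidable
  using (decidable-stable; dec-true; dec-false; ¬¬-excluded-middle; _→-dec_)
open import Relation.Unary using (Pred; Decidable)

open import Algebra.Properties.Semiring.Sum +-*-semiring
  using (sum; sum-cong-≗; ∑-distrib-+; ∑-comm; *-distribˡ-sum)

private variable
  m n : ℕ
  P Q : Set

-- Finite sums

-- Moves terms without truncated subtraction: two ring identities expose the common summand `c`,
-- which is then cancelled.
≤-rearrange : ∀ c {x y a b} → x ≡ c + a → y ≡ c + b → x ≤ y → a ≤ b
≤-rearrange c refl refl = +-cancelˡ-≤ c _ _

sum-mono : {f g : Fin n → ℕ} → (∀ i → f i ≤ g i) → sum f ≤ sum g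
sum-mono {zero}  f≤g = z≤n
sum-mono {suc n} f≤g = +-mono-≤ (f≤g zero) (sum-mono (f≤g ∘ suc))

sum-const : ∀ n c → sum {n} (λ _ → c) ≡ n * c
sum-const zero    c = refl
sum-const (suc n) c = cong (c +_) (sum-const n c)

-- At `k` nothing is known about `f` and `g`, so each side receives the other's value there and the
-- exceptional terms balance.
sum-mono-except₁ : {f g : Fin n → ℕ} → ∀ k → (∀ i → i ≢ k → f i ≤ g i) →
                   sum f + g k ≤ sum g + f k
sum-mono-except₁ {suc n} {f} {g} zero f≤g = begin
  f zero + sum (f ∘ suc) + g zero  ≡⟨ lem (f zero) _ _ ⟩
  g zero + sum (f ∘ suc) + f zero
    ≤⟨ +-monoˡ-≤ (f zero) (+-monoʳ-≤ (g zero) (sum-mono λ i → f≤g (suc i) λ ())) ⟩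
  g zero + sum (g ∘ suc) + f zero  ∎
  where
  open ≤-Reasoning
  lem : ∀ a b c → a + b + c ≡ c + b + a
  lem = solve-∀
sum-mono-except₁ {suc n} {f} {g} (suc k) f≤g = begin
  f zero + sum (f ∘ suc) + g (suc k)    ≡⟨ +-assoc (f zero) _ _ ⟩
  f zero + (sum (f ∘ suc) + g (suc k))  ≤⟨ +-mono-≤ (f≤g zero λ ())
                                             (sum-mono-except₁ k λ i i≢k → f≤g (suc i) (i≢k ∘ suc-injective)) ⟩
  g zero + (sum (g ∘ suc) + f (suc k))  ≡⟨ +-assoc (g zero) _ _ ⟨
  g zero + sum (g ∘ suc) + f (suc k)    ∎
  where open ≤-Reasoning

sum-mono-except₂ : {f g : Fin n → ℕ} → ∀ k l → k ≢ l →
                   (∀ i → i ≢ k → i ≢ l → f i ≤ g i) →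
                   sum f + (g k + g l) ≤ sum g + (f k + f l)
sum-mono-except₂ zero zero k≢l f≤g = contradiction refl k≢l
sum-mono-except₂ {suc n} {f} {g} zero (suc l) k≢l f≤g = begin
  f zero + sum (f ∘ suc) + (g zero + g (suc l))    ≡⟨ lem (f zero) _ _ _ ⟩
  f zero + g zero + (sum (f ∘ suc) + g (suc l))    ≤⟨ +-monoʳ-≤ (f zero + g zero)
     (sum-mono-except₁ l λ i i≢l → f≤g (suc i) (λ ()) (i≢l ∘ suc-injective)) ⟩
  f zero + g zero + (sum (g ∘ suc) + f (suc l))    ≡⟨ lem′ (f zero) _ _ _ ⟩
  g zero + sum (g ∘ suc) + (f zero + f (suc l))    ∎
  where
  open ≤-Reasoning
  lem : ∀ a b c d → a + b + (c + d) ≡ a + c + (b + d)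
  lem = solve-∀
  lem′ : ∀ a c b d → a + c + (b + d) ≡ c + b + (a + d)
  lem′ = solve-∀
sum-mono-except₂ {f = f} {g} (suc k) zero k≢l f≤g =
  subst₂ (λ x y → sum f + x ≤ sum g + y) (+-comm (g zero) _) (+-comm (f zero) _)
    (sum-mono-except₂ {f = f} {g} zero (suc k) (k≢l ∘ sym) λ i i≢k i≢l → f≤g i i≢l i≢k)
sum-mono-except₂ {suc n} {f} {g} (suc k) (suc l) k≢l f≤g = begin
  f zero + sum (f ∘ suc) + (g (suc k) + g (suc l))    ≡⟨ +-assoc (f zero) _ _ ⟩
  f zero + (sum (f ∘ suc) + (g (suc k) + g (suc l)))  ≤⟨ +-mono-≤ (f≤g zero (λ ()) (λ ()))
     (sum-mono-except₂ k l (k≢l ∘ cong suc)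
       λ i i≢k i≢l → f≤g (suc i) (i≢k ∘ suc-injective) (i≢l ∘ suc-injective)) ⟩
  g zero + (sum (g ∘ suc) + (f (suc k) + f (suc l)))  ≡⟨ +-assoc (g zero) _ _ ⟨
  g zero + sum (g ∘ suc) + (f (suc k) + f (suc l))    ∎
  where open ≤-Reasoning

sum-↑ : ∀ m (f : Fin (m + n) → ℕ) →
        sum f ≡ sum (λ i → f (i ↑ˡ n)) + sum (λ j → f (m ↑ʳ j))
sum-↑ zero    f = refl
sum-↑ (suc m) f = trans (cong (f zero +_) (sum-↑ m (f ∘ suc))) (sym (+-assoc (f zero) _ _))

sum-combine : ∀ m (f : Fin (m * n) → ℕ) →
              sum f ≡ sum (λ (i : Fin m) → sum (λ (j : Fin n) → f (combine i j)))
sum-combine         zero    f = refl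
sum-combine {n = n} (suc m) f =
  trans (sum-↑ n f) (cong (sum (λ j → f (j ↑ˡ (m * n))) +_) (sum-combine m (f ∘ (n ↑ʳ_))))

-- Indicators, and counting by sums

⟦_⟧ : Dec P → ℕ
⟦ P? ⟧ = if does P? then 1 else 0

⟦⟧-yes : (P? : Dec P) → P → ⟦ P? ⟧ ≡ 1
⟦⟧-yes (yes _) _ = refl
⟦⟧-yes (no ¬p) p = contradiction p ¬p

⟦⟧-no : (P? : Dec P) → ¬ P → ⟦ P? ⟧ ≡ 0
⟦⟧-no (yes p) ¬p = contradiction p ¬p
⟦⟧-no (no _)  _  = refl

⟦⟧-mono : (P? : Dec P) (Q? : Dec Q) → (P → Q) → ⟦ P? ⟧ ≤ ⟦ Q? ⟧
⟦⟧-mono (no _)  Q? _   = z≤n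
⟦⟧-mono (yes p) Q? P→Q = ≤-reflexive (sym (⟦⟧-yes Q? (P→Q p)))

⟦⟧-cong : (P? : Dec P) (Q? : Dec Q) → (P → Q) → (Q → P) → ⟦ P? ⟧ ≡ ⟦ Q? ⟧
⟦⟧-cong P? Q? P→Q Q→P = ≤-antisym (⟦⟧-mono P? Q? P→Q) (⟦⟧-mono Q? P? Q→P)

module _ {A : Set} {P : Pred A 0ℓ} (P? : Decidable P) where

  length-filter-tabulate : (f : Fin n → A) →
    length (filter P? (tabulate f)) ≡ sum (λ i → ⟦ P? (f i) ⟧)
  length-filter-tabulate {zero}  f = refl
  length-filter-tabulate {suc n} f with does (P? (f zero))
  ... | true  = cong suc (length-filter-tabulate (f ∘ suc))
  ... | false = length-filter-tabulate (f ∘ suc)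

module _ {A B : Set} {P : Pred (A × B) 0ℓ} (P? : Decidable P) where

  length-filter-cartesianProduct : (f : Fin m → A) (g : Fin n → B) →
    length (filter P? (cartesianProduct (tabulate f) (tabulate g))) ≡
    sum (λ i → sum (λ j → ⟦ P? (f i , g j) ⟧))
  length-filter-cartesianProduct {zero}  f g = refl
  length-filter-cartesianProduct {suc m} f g = begin
    length (filter P? (row ++ rows))                 ≡⟨ cong length (filter-++ P? row rows) ⟩
    length (filter P? row ++ filter P? rows)         ≡⟨ length-++ (filter P? row) ⟩
    length (filter P? row) + length (filter P? rows)
      ≡⟨ cong₂ _+_ first (length-filter-cartesianProduct (f ∘ suc) g) ⟩
    sum (λ j → ⟦ P? (f zero , g j) ⟧) + sum (λ i → sum (λ j → ⟦ P? (f (suc i) , g j) ⟧)) ∎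
    where
    open ≡-Reasoning
    row = map (f zero ,_) (tabulate g)
    rows = cartesianProduct (tabulate (f ∘ suc)) (tabulate g)
    first : length (filter P? row) ≡ sum (λ j → ⟦ P? (f zero , g j) ⟧)
    first = trans (cong (length ∘ filter P?) (map-tabulate g (f zero ,_)))
                  (length-filter-tabulate P? ((f zero ,_) ∘ g))

-- Sums over the vertices of a finite graph

module FiniteGraph (H : Graph) where

  open Graph H public renaming (sym to Adj-sym)

  index : V → Fin order
  index = Inverse.to enum

  vertex-index : ∀ v → vertex (index v) ≡ v
  vertex-index = Inverse.strictlyInverseʳ enum

  index-vertex : ∀ i → index (vertex i) ≡ i
  index-vertex = Inverse.strictlyInverseˡ enum

  _≟_ : DecidableEquality V
  u ≟ v with index u ≟ᶠ index v
  ... | yes eq = yes (trans (sym (vertex-index u)) (trans (cong vertex eq) (vertex-index v)))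
  ... | no neq = no (neq ∘ cong index)

  anyᵥ? : {P : Pred V 0ℓ} → Decidable P → Dec (∃ P)
  anyᵥ? {P} P? with any? (P? ∘ vertex)
  ... | yes (i , p) = yes (vertex i , p)
  ... | no ¬p       = no λ (v , p) → ¬p (index v , subst P (sym (vertex-index v)) p)

  allᵥ? : {P : Pred V 0ℓ} → Decidable P → Dec (∀ v → P v)
  allᵥ? {P} P? with all? (P? ∘ vertex)
  ... | yes p = yes λ v → subst P (vertex-index v) (p (index v))
  ... | no ¬p = no λ p → ¬p (p ∘ vertex)

  Σᵥ : (V → ℕ) → ℕ
  Σᵥ f = sum (f ∘ vertex)

  module _ {f g : V → ℕ} where

    Σᵥ-cong : (∀ v → f v ≡ g v) → Σᵥ f ≡ Σᵥ g
    Σᵥ-cong f≗g = sum-cong-≗ (f≗g ∘ vertex)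

    Σᵥ-mono : (∀ v → f v ≤ g v) → Σᵥ f ≤ Σᵥ g
    Σᵥ-mono f≤g = sum-mono (f≤g ∘ vertex)

    Σᵥ-mono-except₁ : ∀ k → (∀ v → v ≢ k → f v ≤ g v) → Σᵥ f + g k ≤ Σᵥ g + f k
    Σᵥ-mono-except₁ k f≤g =
      subst (λ k → Σᵥ f + g k ≤ Σᵥ g + f k) (vertex-index k)
        (sum-mono-except₁ (index k) λ i i≢k → f≤g (vertex i)
          λ eq → i≢k (trans (sym (index-vertex i)) (cong index eq)))

    Σᵥ-mono-except₂ : ∀ k l → k ≢ l → (∀ v → v ≢ k → v ≢ l → f v ≤ g v) →
                      Σᵥ f + (g k + g l) ≤ Σᵥ g + (f k + f l)
    Σᵥ-mono-except₂ k l k≢l f≤g =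
      subst₂ (λ k l → Σᵥ f + (g k + g l) ≤ Σᵥ g + (f k + f l)) (vertex-index k) (vertex-index l)
        (sum-mono-except₂ (index k) (index l)
          (λ eq → k≢l (trans (sym (vertex-index k)) (trans (cong vertex eq) (vertex-index l))))
          λ i i≢k i≢l → f≤g (vertex i)
            (λ eq → i≢k (trans (sym (index-vertex i)) (cong index eq)))
            (λ eq → i≢l (trans (sym (index-vertex i)) (cong index eq))))

  Σᵥ-+ : ∀ f g → Σᵥ (λ v → f v + g v) ≡ Σᵥ f + Σᵥ g
  Σᵥ-+ f g = ∑-distrib-+ (f ∘ vertex) (g ∘ vertex)

  Σᵥ-* : ∀ c f → Σᵥ (λ v → c * f v) ≡ c * Σᵥ f
  Σᵥ-* c f = sym (*-distribˡ-sum c (f ∘ vertex))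

  Σᵥ-swap : ∀ {n} (f : V → Fin n → ℕ) →
            Σᵥ (λ v → sum (f v)) ≡ sum (λ i → Σᵥ (λ v → f v i))
  Σᵥ-swap f = ∑-comm (f ∘ vertex)

  Σᵥ-0 : Σᵥ (λ _ → 0) ≡ 0
  Σᵥ-0 = trans (sum-const order 0) (*-zeroʳ order)

  Σᵥ-support₂ : ∀ {f} k l → k ≢ l → (∀ v → v ≢ k → v ≢ l → f v ≡ 0) → Σᵥ f ≤ f k + f l
  Σᵥ-support₂ {f} k l k≢l f≡0 = begin
    Σᵥ f                         ≡⟨ +-identityʳ _ ⟨
    Σᵥ f + 0                     ≤⟨ Σᵥ-mono-except₂ k l k≢l (λ v p q → ≤-reflexive (f≡0 v p q)) ⟩
    Σᵥ (λ _ → 0) + (f k + f l)   ≡⟨ cong (_+ (f k + f l)) Σᵥ-0 ⟩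
    f k + f l                    ∎
    where open ≤-Reasoning

  Σᵥ-pair : ∀ {f : V → ℕ} k l → k ≢ l → f k + f l ≤ Σᵥ f
  Σᵥ-pair {f} k l k≢l = begin
    f k + f l                    ≡⟨ cong (_+ (f k + f l)) Σᵥ-0 ⟨
    Σᵥ (λ _ → 0) + (f k + f l)   ≤⟨ Σᵥ-mono-except₂ {f = λ _ → 0} {g = f} k l k≢l (λ _ _ _ → z≤n) ⟩
    Σᵥ f + 0                     ≡⟨ +-identityʳ _ ⟩
    Σᵥ f                         ∎
    where open ≤-Reasoning

  term≤Σᵥ : ∀ (f : V → ℕ) k → f k ≤ Σᵥ f
  term≤Σᵥ f k = begin
    f k                     ≤⟨ m≤n+m (f k) _ ⟩
    Σᵥ (λ _ → 0) + f k      ≤⟨ Σᵥ-mono-except₁ {f = λ _ → 0} {g = f} k (λ _ _ → z≤n) ⟩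
    Σᵥ f + 0                ≡⟨ +-identityʳ _ ⟩
    Σᵥ f                    ∎
    where open ≤-Reasoning

  degree-Σᵥ : ∀ u → degree u ≡ Σᵥ (λ v → ⟦ adj? u v ⟧)
  degree-Σᵥ u = trans (cong (length ∘ filter (adj? u)) (map-tabulate id vertex))
                      (length-filter-tabulate (adj? u) vertex)

  module _ (F : EdgeSet H) where

    open EdgeSet F hiding (sym)

    -- Transposing one of two copies of the sum over increasing pairs lists every edge in both
    -- orientations; the diagonal is empty because adjacency is irreflexive.
    2*∣∣≡Σᵥ : 2 * ∣_∣ ≡ Σᵥ (λ u → Σᵥ (λ v → ⟦ in? u v ⟧))
    2*∣∣≡Σᵥ = begin
      2 * ∣_∣                                        ≡⟨ cong (∣_∣ +_) (+-identityʳ ∣_∣) ⟩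
      ∣_∣ + ∣_∣
        ≡⟨ cong (λ k → k + k) (length-filter-cartesianProduct up? id id) ⟩
      ↑ + ↑
        ≡⟨ cong (↑ +_) (∑-comm (λ i j → ⟦ up? (i , j) ⟧)) ⟩
      ↑ + sum (λ i → sum (λ j → ⟦ up? (j , i) ⟧))
        ≡⟨ ∑-distrib-+ (λ i → sum (λ j → ⟦ up? (i , j) ⟧)) _ ⟨
      sum (λ i → sum (λ j → ⟦ up? (i , j) ⟧) + sum (λ j → ⟦ up? (j , i) ⟧))
        ≡⟨ sum-cong-≗ (λ i → trans (sym (∑-distrib-+ (λ j → ⟦ up? (i , j) ⟧) _))
                                   (sum-cong-≗ (both i))) ⟩
      Σᵥ (λ u → Σᵥ (λ v → ⟦ in? u v ⟧))              ∎
      where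
      open ≡-Reasoning
      up? : (ij : Fin order × Fin order) →
            Dec (proj₁ ij <ᶠ proj₂ ij × In (vertex (proj₁ ij)) (vertex (proj₂ ij)))
      up? (i , j) = (i <ᶠ? j) ×-dec in? (vertex i) (vertex j)
      ↑ = sum (λ i → sum (λ j → ⟦ up? (i , j) ⟧))
      both : ∀ i j → ⟦ up? (i , j) ⟧ + ⟦ up? (j , i) ⟧ ≡ ⟦ in? (vertex i) (vertex j) ⟧
      both i j with <-cmp i j
      ... | tri< i<j _ j≮i = trans (cong₂ _+_
              (⟦⟧-cong (up? (i , j)) (in? _ _) proj₂ (i<j ,_)) (⟦⟧-no (up? (j , i)) (j≮i ∘ proj₁))) (+-identityʳ _)
      ... | tri> i≮j _ j<i = cong₂ _+_ (⟦⟧-no (up? (i , j)) (i≮j ∘ proj₁))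
              (⟦⟧-cong (up? (j , i)) (in? _ _) (EdgeSet.sym F ∘ proj₂) λ f → j<i , EdgeSet.sym F f)
      ... | tri≈ i≮j refl _ = trans (cong₂ _+_ (⟦⟧-no (up? (i , i)) (i≮j ∘ proj₁)) (⟦⟧-no (up? (i , i)) (i≮j ∘ proj₁)))
              (sym (⟦⟧-no (in? _ _) (irrefl refl ∘ ⊆Adj)))

-- Sums and degrees in a direct product

module _ (G H : Graph) where

  private
    module G = FiniteGraph G
    module H = FiniteGraph H
    module G⊗H = FiniteGraph (G ⊗ H)

  Σᵥ-⊗ : ∀ f → G⊗H.Σᵥ f ≡ G.Σᵥ (λ u → H.Σᵥ (λ v → f (u , v)))
  Σᵥ-⊗ f = trans (sum-combine G.order (f ∘ G⊗H.vertex))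
    (sum-cong-≗ λ i → sum-cong-≗ λ j →
      cong (λ (p , q) → f (G.vertex p , H.vertex q)) (remQuot-combine {k = H.order} i j))

  degree-⊗ : ∀ u v → G⊗H.degree (u , v) ≡ G.degree u * H.degree v
  degree-⊗ u v = begin
    G⊗H.degree (u , v)                    ≡⟨ G⊗H.degree-Σᵥ (u , v) ⟩
    G⊗H.Σᵥ (λ w → ⟦ G⊗H.adj? (u , v) w ⟧) ≡⟨ Σᵥ-⊗ (λ w → ⟦ G⊗H.adj? (u , v) w ⟧) ⟩
    G.Σᵥ (λ u′ → H.Σᵥ (λ v′ → ⟦ G.adj? u u′ ×-dec H.adj? v v′ ⟧))
      ≡⟨ G.Σᵥ-cong (λ u′ → trans (H.Σᵥ-cong (λ v′ → ⟦×⟧ (G.adj? u u′) (H.adj? v v′)))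
                                 (H.Σᵥ-* ⟦ G.adj? u u′ ⟧ (λ v′ → ⟦ H.adj? v v′ ⟧))) ⟩
    G.Σᵥ (λ u′ → ⟦ G.adj? u u′ ⟧ * H.Σᵥ (λ v′ → ⟦ H.adj? v v′ ⟧))
      ≡⟨ G.Σᵥ-cong (λ u′ → trans (cong (⟦ G.adj? u u′ ⟧ *_) (sym (H.degree-Σᵥ v)))
                                 (*-comm ⟦ G.adj? u u′ ⟧ (H.degree v))) ⟩
    G.Σᵥ (λ u′ → H.degree v * ⟦ G.adj? u u′ ⟧) ≡⟨ G.Σᵥ-* (H.degree v) (λ u′ → ⟦ G.adj? u u′ ⟧) ⟩
    H.degree v * G.Σᵥ (λ u′ → ⟦ G.adj? u u′ ⟧) ≡⟨ cong (H.degree v *_) (G.degree-Σᵥ u) ⟨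
    H.degree v * G.degree u                    ≡⟨ *-comm (H.degree v) _ ⟩
    G.degree u * H.degree v                    ∎
    where
    open ≡-Reasoning
    ⟦×⟧ : (P? : Dec P) (Q? : Dec Q) → ⟦ P? ×-dec Q? ⟧ ≡ ⟦ P? ⟧ * ⟦ Q? ⟧
    ⟦×⟧ (yes _) Q? = sym (+-identityʳ _)
    ⟦×⟧ (no _)  Q? = refl

-- Edge boundaries

degree-K : (i : Fin n) → suc (Graph.degree (K n) i) ≡ n
degree-K {n} i = ≤-antisym
  (begin
    suc (degree i)                              ≡⟨ cong suc (degree-Σᵥ i) ⟩
    suc (Σᵥ adj)                                ≡⟨ +-comm _ 1 ⟨
    Σᵥ adj + 1
      ≤⟨ Σᵥ-mono-except₁ {f = adj} {λ _ → 1} i (λ j j≢i → ≤-reflexive (adj≡1 j j≢i)) ⟩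
    Σᵥ (λ _ → 1) + adj i                        ≡⟨ cong₂ _+_ ones adj≡0 ⟩
    n + 0                                       ≡⟨ +-identityʳ n ⟩
    n                                           ∎)
  (begin
    n                                           ≡⟨ +-identityʳ n ⟨
    n + 0                                       ≡⟨ cong₂ _+_ ones adj≡0 ⟨
    Σᵥ (λ _ → 1) + adj i
      ≤⟨ Σᵥ-mono-except₁ {f = λ _ → 1} {adj} i (λ j j≢i → ≤-reflexive (sym (adj≡1 j j≢i))) ⟩
    Σᵥ adj + 1                                  ≡⟨ +-comm _ 1 ⟩
    suc (Σᵥ adj)                                ≡⟨ cong suc (degree-Σᵥ i) ⟨
    suc (degree i)                              ∎)
  where
  open FiniteGraph (K n)
  open ≤-Reasoning
  adj : Fin n → ℕ
  adj j = ⟦ adj? i j ⟧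
  adj≡1 : ∀ j → j ≢ i → adj j ≡ 1
  adj≡1 j j≢i = ⟦⟧-yes (adj? i j) (j≢i ∘ sym)
  adj≡0 : adj i ≡ 0
  adj≡0 = ⟦⟧-no (adj? i i) (λ i≢i → i≢i refl)
  ones : Σᵥ (λ _ → 1) ≡ n
  ones = trans (sum-const n 1) (*-identityʳ n)

module _ (H : Graph) where

  open FiniteGraph H

  -- The edge boundary of the vertex set with characteristic function `S`; Boolean values keep
  -- membership decidable.
  ∂ : (V → Bool) → EdgeSet H
  ∂ S = record
    { In   = λ x y → Adj x y × S x ≢ S y
    ; in?  = λ x y → adj? x y ×-dec ¬? (S x Bool.≟ S y)
    ; sym  = λ (a , ne) → Adj-sym a , ne ∘ sym
    ; ⊆Adj = proj₁
    }

  -- `S` is constant along walks avoiding `∂ S`, so the two sides are separated; the edge to a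
  -- neighbour on the same side survives, so no vertex becomes isolated.
  ∂-restricted : (S : V → Bool) → ∃ (λ x → S x ≡ true) → ∃ (λ x → S x ≡ false) →
                 (∀ x → ∃ λ y → Adj x y × S x ≡ S y) → IsRestrictedEdgeCut H (∂ S)
  ∂-restricted S (x , Sx) (y , Sy) nb =
    (λ conn → not-¬ Sx (trans (sym (constant (conn x y))) Sy ))
    , λ r → let (s , r~s , Sr≡Ss) = nb r in
        r , s , ε , (r~s , λ (_ , ne) → ne Sr≡Ss) ◅ ε , λ r≡s → irrefl r≡s r~s
    where
    constant : ∀ {x y} → Star (Graph.Adj (H ─ ∂ S)) x y → S y ≡ S x
    constant ε = refl
    constant {x} (_◅_ {j = z} (a , ∉∂) zs) =
      trans (constant zs) (sym (decidable-stable (S x Bool.≟ S z) (λ ne → ∉∂ (a , ne))))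

  pair : V → V → V → Bool
  pair x y z = does (z ≟ x) ∨ does (z ≟ y)

  pair-∋₁ : ∀ x y → pair x y x ≡ true
  pair-∋₁ x y = cong (_∨ does (x ≟ y)) (dec-true (x ≟ x) refl)

  pair-∋₂ : ∀ x y → pair x y y ≡ true
  pair-∋₂ x y = trans (cong (does (y ≟ x) ∨_) (dec-true (y ≟ y) refl)) (∨-zeroʳ _)

  pair-∌ : ∀ {x y z} → z ≢ x → z ≢ y → pair x y z ≡ false
  pair-∌ {x} {y} {z} z≢x z≢y = cong₂ _∨_ (dec-false (z ≟ x) z≢x) (dec-false (z ≟ y) z≢y)

  -- The edge `x y` is counted by both degrees but lies inside the pair, whence the summand 2.
  ∣∂-pair∣ : ∀ {x y} → Adj x y → EdgeSet.∣ ∂ (pair x y) ∣ + 2 ≤ degree x + degree y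
  ∣∂-pair∣ {x} {y} x~y = *-cancelˡ-≤ 2 (begin
    2 * (∣∂∣ + 2)                              ≡⟨ *-distribˡ-+ 2 ∣∂∣ 2 ⟩
    2 * ∣∂∣ + 4                                ≡⟨ cong (_+ 4) (2*∣∣≡Σᵥ (∂ S)) ⟩
    Σᵥ row + 4                                 ≤⟨ +-monoˡ-≤ 4 total ⟩
    row x + row y + (row x + row y) + 4        ≡⟨ lem (row x) (row y) ⟩
    2 * (row x + 1 + (row y + 1))              ≤⟨ *-monoʳ-≤ 2 (+-mono-≤ rowx rowy) ⟩
    2 * (degree x + degree y)                  ∎)
    where
    open ≤-Reasoning
    S = pair x y
    ∣∂∣ = EdgeSet.∣ ∂ S ∣
    x≢y : x ≢ y
    x≢y x≡y = irrefl x≡y x~y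
    b : V → V → ℕ
    b u v = ⟦ EdgeSet.in? (∂ S) u v ⟧
    row : V → ℕ
    row u = Σᵥ (b u)
    b-sym : ∀ u v → b u v ≡ b v u
    b-sym u v = ⟦⟧-cong (EdgeSet.in? (∂ S) u v) (EdgeSet.in? (∂ S) v u)
      (EdgeSet.sym (∂ S) {u} {v}) (EdgeSet.sym (∂ S) {v} {u})
    b≡0 : ∀ {u v} → S u ≡ S v → b u v ≡ 0
    b≡0 {u} {v} eq = ⟦⟧-no (EdgeSet.in? (∂ S) u v) (λ (_ , ne) → ne eq)
    col : V → ℕ
    col u = b u x + b u y
    Sx = pair-∋₁ x y
    Sy = pair-∋₂ x y
    col≡0 : ∀ {z} → S z ≡ true → col z ≡ 0
    col≡0 Sz = cong₂ _+_ (b≡0 (trans Sz (sym Sx))) (b≡0 (trans Sz (sym Sy)))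
    -- Every boundary edge has an end in the pair: rows outside the pair are supported on the
    -- columns `x` and `y`.
    total : Σᵥ row ≤ row x + row y + (row x + row y)
    total = begin
      Σᵥ row                               ≡⟨ +-identityʳ _ ⟨
      Σᵥ row + 0                           ≡⟨ cong (Σᵥ row +_) (cong₂ _+_ (col≡0 Sx) (col≡0 Sy)) ⟨
      Σᵥ row + (col x + col y)             ≤⟨ Σᵥ-mono-except₂ {f = row} {col} x y x≢y (λ z z≢x z≢y →
                                                Σᵥ-support₂ {f = b z} x y x≢y λ w w≢x w≢y →
                                                  b≡0 (trans (pair-∌ z≢x z≢y) (sym (pair-∌ w≢x w≢y)))) ⟩
      Σᵥ col + (row x + row y)
        ≡⟨ cong (_+ (row x + row y)) (Σᵥ-+ (λ u → b u x) (λ u → b u y)) ⟩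
      Σᵥ (λ u → b u x) + Σᵥ (λ u → b u y) + (row x + row y)
        ≡⟨ cong (_+ (row x + row y)) (cong₂ _+_ (Σᵥ-cong (λ u → b-sym u x)) (Σᵥ-cong (λ u → b-sym u y))) ⟩
      row x + row y + (row x + row y)      ∎
    -- The neighbour `v` on the same side counts towards the degree of `u` but not towards its row.
    row-bound : ∀ u v → S u ≡ S v → Adj u v → row u + 1 ≤ degree u
    row-bound u v Su≡Sv u~v = begin
      row u + 1                       ≡⟨ cong (row u +_) (⟦⟧-yes (adj? u v) u~v) ⟨
      row u + ⟦ adj? u v ⟧            ≤⟨ Σᵥ-mono-except₁ {f = b u} {λ w → ⟦ adj? u w ⟧} v (λ w _ →
                                           ⟦⟧-mono (EdgeSet.in? (∂ S) u w) (adj? u w) proj₁) ⟩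
      Σᵥ (λ w → ⟦ adj? u w ⟧) + b u v ≡⟨ cong₂ _+_ (sym (degree-Σᵥ u)) (b≡0 Su≡Sv) ⟩
      degree u + 0                    ≡⟨ +-identityʳ _ ⟩
      degree u                        ∎
    rowx : row x + 1 ≤ degree x
    rowx = row-bound x y (trans Sx (sym Sy)) x~y
    rowy : row y + 1 ≤ degree y
    rowy = row-bound y x (trans Sy (sym Sx)) (Adj-sym x~y)
    lem : ∀ a b → a + b + (a + b) + 4 ≡ 2 * (a + 1 + (b + 1))
    lem = solve-∀

  1≤degree : ∀ {u v} → Adj u v → 1 ≤ degree u
  1≤degree {u} {v} u~v = begin
    1                           ≡⟨ ⟦⟧-yes (adj? u v) u~v ⟨
    ⟦ adj? u v ⟧                ≤⟨ term≤Σᵥ (λ w → ⟦ adj? u w ⟧) v ⟩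
    Σᵥ (λ w → ⟦ adj? u w ⟧)     ≡⟨ degree-Σᵥ u ⟨
    degree u                    ∎
    where open ≤-Reasoning

  edgeDegree+2 : ∀ {u v} → Adj u v → edgeDegree u v + 2 ≡ degree u + degree v
  edgeDegree+2 u~v = m∸n+n≡m (+-mono-≤ (1≤degree u~v) (1≤degree (Adj-sym u~v)))

  connected⇒neighbour : Nontrivial → Connected → ∀ u → ∃ (Adj u)
  connected⇒neighbour 2≤order conn u = firstStep (conn u w) u≢w
    where
    other : ∀ {n} → 2 ≤ n → (i : Fin n) → ∃ (λ j → i ≢ j)
    other {1}           (s≤s ())
    other {suc (suc n)} _ zero    = 1F , λ ()
    other {suc (suc n)} _ (suc i) = 0F , λ ()
    j = proj₁ (other 2≤order (index u))
    w = vertex j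
    u≢w : u ≢ w
    u≢w u≡w = proj₂ (other 2≤order (index u)) (trans (cong index u≡w) (index-vertex j))
    firstStep : ∀ {v} → Star Adj u v → u ≢ v → ∃ (Adj u)
    firstStep ε       u≢v = contradiction refl u≢v
    firstStep (a ◅ _) _   = _ , a

-- A restricted edge-cut of the product with at most M edges

module _ (G : Graph) (nontrivial : Graph.Nontrivial G) (connected : Graph.Connected G)
         {k ξ : ℕ} (isξ : Isξ G ξ) where

  private
    n′ = 5 + k
    H = G ⊗ K n′
    module G = FiniteGraph G
    module H = FiniteGraph H

  -- Cuts off the edge from `(u , 0)` to `(v , 1)`, where `u v` attains the minimum edge-degree of
  -- `G`. Writing `n` as `5 + k` makes the arithmetic a ring identity.
  restrictedCut-5+ : ∃ λ F → IsRestrictedEdgeCut H F × EdgeSet.∣ F ∣ ≤ (4 + k) * ξ + 2 * (3 + k)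
  restrictedCut-5+ with (u , v , u~v , dd≡ξ) ← proj₁ isξ = ∂ H S , ∂-restricted H S
      (x , Sx) ((u , 2F) , pair-∌ H (λ ()) (λ ())) nb , ≤-rearrange 2 lhs rhs (∣∂-pair∣ H x~y)
    where
    x y : H.V
    x = u , 0F
    y = v , 1F
    x~y : H.Adj x y
    x~y = u~v , λ ()
    S = pair H x y
    Sx = pair-∋₁ H x y
    Sy = pair-∋₂ H x y
    ∣∂∣ = EdgeSet.∣ ∂ H S ∣
    lhs : ∣∂∣ + 2 ≡ 2 + ∣∂∣
    lhs = +-comm ∣∂∣ 2
    K-degree : ∀ i → H.degree (i) ≡ G.degree (proj₁ i) * (4 + k)
    K-degree (w , i) = trans (degree-⊗ G (K n′) w i) (cong (λ d → G.degree w * pred d) (degree-K i))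
    -- The degrees add up to (n-1)(ξ+2) = M + 2; the 2 accounts for the edge `x y`, seen from both
    -- ends.
    rhs : H.degree x + H.degree y ≡ 2 + ((4 + k) * ξ + 2 * (3 + k))
    rhs = begin
      H.degree x + H.degree y                        ≡⟨ cong₂ _+_ (K-degree x) (K-degree y) ⟩
      G.degree u * (4 + k) + G.degree v * (4 + k)    ≡⟨ *-distribʳ-+ (4 + k) (G.degree u) _ ⟨
      (G.degree u + G.degree v) * (4 + k)            ≡⟨ cong (_* (4 + k)) (edgeDegree+2 G u~v) ⟨
      (G.edgeDegree u v + 2) * (4 + k)               ≡⟨ cong (λ d → (d + 2) * (4 + k)) dd≡ξ ⟩
      (ξ + 2) * (4 + k)                              ≡⟨ lem ξ k ⟩
      2 + ((4 + k) * ξ + 2 * (3 + k))                ∎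
      where
      open ≡-Reasoning
      lem : ∀ ξ k → (ξ + 2) * (4 + k) ≡ 2 + ((4 + k) * ξ + 2 * (3 + k))
      lem = solve-∀
    -- A neighbour whose second coordinate is neither 0 nor 1 lies outside the pair.
    fresh : (i : Fin n′) → ∃ λ j → i ≢ j × j ≢ 0F × j ≢ 1F
    fresh 0F = 2F , (λ ()) , (λ ()) , (λ ())
    fresh 1F = 2F , (λ ()) , (λ ()) , (λ ())
    fresh 2F = 3F , (λ ()) , (λ ()) , (λ ())
    fresh (suc (suc (suc i))) = 2F , (λ ()) , (λ ()) , (λ ())
    nb : ∀ z → ∃ λ w → H.Adj z w × S z ≡ S w
    nb z = go (z H.≟ x) (z H.≟ y)
      where
      go : Dec (z ≡ x) → Dec (z ≡ y) → ∃ λ w → H.Adj z w × S z ≡ S w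
      go (yes refl) _          = y , x~y , trans Sx (sym Sy)
      go (no _)     (yes refl) = x , H.Adj-sym {x} {y} x~y , trans Sy (sym Sx)
      go (no z≢x)   (no z≢y)   =
        let (q , p~q) = connected⇒neighbour G nontrivial connected (proj₁ z)
            (j , i≢j , j≢0 , j≢1) = fresh (proj₂ z)
        in (q , j) , (p~q , i≢j) , trans (pair-∌ H z≢x z≢y)
             (sym (pair-∌ H (j≢0 ∘ cong proj₂) (j≢1 ∘ cong proj₂)))

restrictedCut-ξ : ∀ G → Graph.Nontrivial G → Graph.Connected G → ∀ {n ξ} → 5 ≤ n → Isξ G ξ →
  ∃ λ F → IsRestrictedEdgeCut (G ⊗ K n) F × EdgeSet.∣ F ∣ ≤ (n ∸ 1) * ξ + 2 * (n ∸ 2)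
restrictedCut-ξ G nontrivial connected (s≤s (s≤s (s≤s (s≤s (s≤s z≤n))))) =
  restrictedCut-5+ G nontrivial connected

-- The number of edges of a cut between two adjacent fibres

-- Here 1 + A and 1 + A′ are the numbers of vertices of one fibre inside and outside X, 1 + B and
-- 1 + B′ those of an adjacent fibre, and C is the number of cut edges between the two. With the
-- units split off, the lower bounds for C share the term A B′ + A′ B.
Extremal : (A A′ B B′ C : ℕ) → Set
Extremal A A′ B B′ C = (A + A′) + (B + B′) < C
                     ⊎ (A + A′) + (B + B′) ≤ C × ((A ≡ 0 × B ≡ 0) ⊎ (A′ ≡ 0 × B′ ≡ 0))

module _ {N C : ℕ} (3≤N : 3 ≤ N) where

  private
    ≤-slack : ∀ {a b} r → a + r ≡ b → a ≤ b
    ≤-slack r refl = m≤m+n _ r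

  -- This is the case `A = 0` with a positive count `suc B` in the other fibre: the lower bound for
  -- `C` exceeds 2N by at least `B + B′`, which is N - 1.
  large-if-zero : ∀ {A′ B B′} → A′ ≡ N → suc B + B′ ≡ N →
                  A′ * suc B + (A′ + B′) ≤ C → A′ + (suc B + B′) < C
  large-if-zero {_} {B} {B′} refl refl bound = begin-strict
    N + N                        <⟨ n<1+n _ ⟩
    1 + (N + N)                  ≤⟨ +-monoˡ-≤ (N + N) (≤-trans (s≤s z≤n) (s≤s⁻¹ 3≤N)) ⟩
    (B + B′) + (N + N)           ≤⟨ ≤-slack ((B + B′) * B) (lem B B′) ⟩
    N * suc B + (N + B′)         ≤⟨ bound ⟩
    C                            ∎
    where
    open ≤-Reasoning
    lem : ∀ B B′ → (B + B′) + (suc (B + B′) + suc (B + B′)) + (B + B′) * B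
                   ≡ suc (B + B′) * suc B + (suc (B + B′) + B′)
    lem = solve-∀

  -- When all four counts are positive and one is at least 2, the difference of the two sides is a
  -- polynomial with nonnegative coefficients.
  large-if-two : ∀ a a′ b b′ →
    let A = 1 + a ; A′ = 2 + a′ ; B = 1 + b ; B′ = 1 + b′ in
    A * B′ + A′ * B + (A′ + B′) ≤ C → (A + A′) + (B + B′) < C
  large-if-two a a′ b b′ = ≤-trans (≤-slack (a * b′ + b′ + b + a′ + a′ * b) (lem a a′ b b′))
    where
    lem : ∀ a a′ b b′ → suc ((1 + a + (2 + a′)) + (1 + b + (1 + b′))) + (a * b′ + b′ + b + a′ + a′ * b)
          ≡ (1 + a) * (1 + b′) + (2 + a′) * (1 + b) + ((2 + a′) + (1 + b′))
    lem = solve-∀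

  -- Cases by which counts vanish. Exchanging the fibres or the sides reduces most of them to
  -- `large-if-zero` and `large-if-two`.
  extremal : ∀ A A′ B B′ → A + A′ ≡ N → B + B′ ≡ N →
             A * B′ + A′ * B + (A + B) ≤ C → A * B′ + A′ * B + (A′ + B′) ≤ C →
             Extremal A A′ B B′ C
  extremal zero A′ zero B′ A+A′ B+B′ low high =
    inj₂ (≤-trans (m≤n+m _ (A′ * 0)) high , inj₁ (refl , refl))
  extremal zero A′ (suc B) B′ A+A′ B+B′ low high = inj₁ (large-if-zero A+A′ B+B′ high)
  extremal (suc A) A′ zero B′ A+A′ B+B′ low high =
    inj₁ (subst (_< C) (+-comm B′ _) (large-if-zero B+B′ A+A′ (subst (_≤ C) (lem A A′ B′) high)))
    where
    lem : ∀ A A′ B′ → suc A * B′ + A′ * 0 + (A′ + B′) ≡ B′ * suc A + (B′ + A′)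
    lem = solve-∀
  extremal (suc A) zero (suc B) zero A+A′ B+B′ low high =
    inj₂ (subst (_≤ C) (lem A B) low , inj₂ (refl , refl))
    where
    lem : ∀ A B → suc A * 0 + 0 * suc B + (suc A + suc B) ≡ suc A + 0 + (suc B + 0)
    lem = solve-∀
  extremal (suc A) zero (suc B) (suc B′) A+A′ B+B′ low high =
    inj₁ (subst (_< C) (lem₂ A B B′)
      (large-if-zero (trans (sym (+-identityʳ _)) A+A′) (trans (+-comm (suc B′) _) B+B′)
        (subst (_≤ C) (lem A B B′) low)))
    where
    lem : ∀ A B B′ → suc A * suc B′ + 0 * suc B + (suc A + suc B) ≡ suc A * suc B′ + (suc A + suc B)
    lem = solve-∀
    lem₂ : ∀ A B B′ → suc A + (suc B′ + suc B) ≡ suc A + 0 + (suc B + suc B′)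
    lem₂ = solve-∀
  extremal (suc A) (suc A′) (suc B) zero A+A′ B+B′ low high =
    inj₁ (subst (_< C) (lem₂ A A′ B)
      (large-if-zero (trans (sym (+-identityʳ _)) B+B′) (trans (+-comm (suc A′) _) A+A′)
        (subst (_≤ C) (lem A A′ B) low)))
    where
    lem : ∀ A A′ B → suc A * 0 + suc A′ * suc B + (suc A + suc B) ≡ suc B * suc A′ + (suc B + suc A)
    lem = solve-∀
    lem₂ : ∀ A A′ B → suc B + (suc A′ + suc A) ≡ suc A + suc A′ + (suc B + 0)
    lem₂ = solve-∀
  extremal (suc A) (suc (suc A′)) (suc B) (suc B′) A+A′ B+B′ low high = inj₁ (large-if-two A A′ B B′ high)
  extremal (suc A) 1 (suc B) (suc (suc B′)) A+A′ B+B′ low high =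
    inj₁ (subst (_< C) (+-comm (suc B + (2 + B′)) _) (large-if-two B B′ A 0
      (subst (_≤ C) (lem A B B′) high)))
    where
    lem : ∀ A B B′ → suc A * (2 + B′) + 1 * suc B + (1 + (2 + B′))
          ≡ suc B * 1 + (2 + B′) * suc A + (2 + B′ + 1)
    lem = solve-∀
  -- Here `low` exceeds 2N by exactly `A + B`, and `3 ≤ N` makes `A` positive.
  extremal (suc A) 1 (suc B) 1 A+A′ B+B′ low high = inj₁ (begin-strict
    suc A + 1 + (suc B + 1)                       <⟨ n<1+n _ ⟩
    1 + (suc A + 1 + (suc B + 1))
      ≤⟨ +-monoˡ-≤ (suc A + 1 + (suc B + 1)) (≤-trans (s≤s⁻¹ (s≤s⁻¹ 3≤A)) (m≤m+n A B)) ⟩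
    A + B + (suc A + 1 + (suc B + 1))             ≡⟨ lem A B ⟩
    suc A * 1 + 1 * suc B + (suc A + suc B)       ≤⟨ low ⟩
    C                                             ∎)
    where
    open ≤-Reasoning
    3≤A : 3 ≤ 2 + A
    3≤A = subst (3 ≤_) (trans (sym A+A′) (+-comm (suc A) 1)) 3≤N
    lem : ∀ A B → A + B + (suc A + 1 + (suc B + 1)) ≡ suc A * 1 + 1 * suc B + (suc A + suc B)
    lem = solve-∀

cut-size : ∀ {n a a′ b b′ C} → 5 ≤ n → 1 ≤ a → 1 ≤ a′ → 1 ≤ b → 1 ≤ b′ → a + a′ ≡ n → b + b′ ≡ n →
           a * b′ + a′ * b ≤ C + (a + b) → a′ * b + a * b′ ≤ C + (a′ + b′) →
           2 * (n ∸ 2) < C ⊎ 2 * (n ∸ 2) ≤ C × ((a ≡ 1 × b ≡ 1) ⊎ (a′ ≡ 1 × b′ ≡ 1))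
cut-size {a = suc A} {suc A′} {suc B} {suc B′} {C} (s≤s (s≤s {n = N} 3≤N)) _ _ _ _ a+a′ b+b′ low high =
  -- Cancelling `a + b` from the first bound leaves `A′ + B′`, and conversely, so the two bounds
  -- enter `extremal` in exchanged order.
  result (extremal {C = C} 3≤N A A′ B B′ αN βN
    (≤-rearrange (2 + A′ + B′) (lem₂ A A′ B B′) (+-comm C _) high′)
    (≤-rearrange (2 + A + B) (lem₁ A A′ B B′) (trans (+-comm C _) (cong (λ x → suc x + C) (+-suc A B))) low))
  where
  αN : A + A′ ≡ N
  αN = cong (pred ∘ pred) (trans (sym (+-suc (suc A) A′)) a+a′)
  βN : B + B′ ≡ N
  βN = cong (pred ∘ pred) (trans (sym (+-suc (suc B) B′)) b+b′)
  lem₁ : ∀ A A′ B B′ → suc A * suc B′ + suc A′ * suc B ≡ 2 + A + B + (A * B′ + A′ * B + (A′ + B′))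
  lem₁ = solve-∀
  lem₂ : ∀ A A′ B B′ → suc A′ * suc B + suc A * suc B′ ≡ 2 + A′ + B′ + (A * B′ + A′ * B + (A + B))
  lem₂ = solve-∀
  high′ : suc A′ * suc B + suc A * suc B′ ≤ C + (2 + A′ + B′)
  high′ = subst (λ x → suc A′ * suc B + suc A * suc B′ ≤ C + x) (cong suc (+-suc A′ B′)) high
  2N : (A + A′) + (B + B′) ≡ 2 * N
  2N = trans (cong₂ _+_ αN βN) (cong (N +_) (sym (+-identityʳ _)))
  result : Extremal A A′ B B′ C → _
  result (inj₁ big) = inj₁ (subst (_< C) 2N big)
  result (inj₂ (bound , inj₁ (A≡0 , B≡0))) = inj₂ (subst (_≤ C) 2N bound , inj₁ (cong suc A≡0 , cong suc B≡0))
  result (inj₂ (bound , inj₂ (A≡0 , B≡0))) = inj₂ (subst (_≤ C) 2N bound , inj₂ (cong suc A≡0 , cong suc B≡0))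

count : Bool → (Fin n → Bool) → ℕ
count b α = sum (λ i → ⟦ α i Bool.≟ b ⟧)

count-total : (α : Fin n → Bool) → ∀ b → count b α + count (not b) α ≡ n
count-total {n} α b = begin
  count b α + count (not b) α
    ≡⟨ ∑-distrib-+ (λ i → ⟦ α i Bool.≟ b ⟧) _ ⟨
  sum (λ i → ⟦ α i Bool.≟ b ⟧ + ⟦ α i Bool.≟ not b ⟧)         ≡⟨ sum-cong-≗ (λ i → one (α i) b) ⟩
  sum {n} (λ _ → 1)                                           ≡⟨ sum-const n 1 ⟩
  n * 1                                                       ≡⟨ *-identityʳ n ⟩
  n                                                           ∎
  where
  open ≡-Reasoning
  one : ∀ x b → ⟦ x Bool.≟ b ⟧ + ⟦ x Bool.≟ not b ⟧ ≡ 1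
  one true  true  = refl
  one true  false = refl
  one false true  = refl
  one false false = refl

1≤count : ∀ {α : Fin n → Bool} {b} i → α i ≡ b → 1 ≤ count b α
1≤count {n} {α} {b} i αi≡b = begin
  1                  ≡⟨ ⟦⟧-yes (α i Bool.≟ b) αi≡b ⟨
  ⟦ α i Bool.≟ b ⟧   ≤⟨ FiniteGraph.term≤Σᵥ (K n) (λ i → ⟦ α i Bool.≟ b ⟧) i ⟩
  count b α          ∎
  where open ≤-Reasoning

count≡1⇒unique : ∀ {α : Fin n → Bool} {b i j} → count b α ≡ 1 → α i ≡ b → α j ≡ b → i ≡ j
count≡1⇒unique {n} {α} {b} {i} {j} count≡1 αi≡b αj≡b with i ≟ᶠ j
... | yes i≡j = i≡j
... | no i≢j  = contradiction (begin
  2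
    ≡⟨ cong₂ _+_ (⟦⟧-yes (α i Bool.≟ b) αi≡b) (⟦⟧-yes (α j Bool.≟ b) αj≡b) ⟨
  ⟦ α i Bool.≟ b ⟧ + ⟦ α j Bool.≟ b ⟧
    ≤⟨ FiniteGraph.Σᵥ-pair (K n) {f = λ i → ⟦ α i Bool.≟ b ⟧} i j i≢j ⟩
  count b α                              ≡⟨ count≡1 ⟩
  1                                      ∎) λ { (s≤s ()) }
  where open ≤-Reasoning

-- The condition `i ≢ j` is adjacency in `K n`: these are the edges between two adjacent fibres
-- whose ends have different colours `α i` and `β j`.
differ? : (α β : Fin n → Bool) → ∀ i j → Dec (i ≢ j × α i ≢ β j)
differ? α β i j = ¬? (i ≟ᶠ j) ×-dec ¬? (α i Bool.≟ β j)

cut : (α β : Fin n → Bool) → ℕ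
cut α β = sum (λ i → sum (λ j → ⟦ differ? α β i j ⟧))

-- Every vertex coloured `not b` is joined to `n ∸ 1` vertices of the other fibre, all coloured `b`.
cut-pure : ∀ {α β : Fin n → Bool} {b} → (∀ j → β j ≡ b) → (n ∸ 1) * count (not b) α ≤ cut α β
cut-pure {n} {α} {β} {b} β≡b = begin
  c * count (not b) α                             ≡⟨ *-distribˡ-sum c (λ i → ⟦ α i Bool.≟ not b ⟧) ⟩
  sum (λ i → c * ⟦ α i Bool.≟ not b ⟧)            ≤⟨ sum-mono row ⟩
  cut α β                                         ∎
  where
  c = n ∸ 1
  open ≤-Reasoning
  open FiniteGraph (K n) using (adj?; degree; degree-Σᵥ)
  row : ∀ i → c * ⟦ α i Bool.≟ not b ⟧ ≤ sum (λ j → ⟦ differ? α β i j ⟧)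
  row i with α i Bool.≟ not b
  ... | no _ = ≤-trans (≤-reflexive (*-zeroʳ c)) z≤n
  ... | yes αi≡¬b = begin
    c * 1                              ≡⟨ trans (*-identityʳ c) (cong (_∸ 1) (sym (degree-K i))) ⟩
    degree i                           ≡⟨ degree-Σᵥ i ⟩
    sum (λ j → ⟦ adj? i j ⟧)           ≤⟨ sum-mono (λ j → ⟦⟧-mono (adj? i j) (differ? α β i j)
                                            λ i≢j → i≢j , λ αi≡βj → not-¬ (trans αi≡βj (β≡b j)) αi≡¬b) ⟩
    sum (λ j → ⟦ differ? α β i j ⟧)    ∎

-- The products count all differently coloured pairs. Only pairs with `i = j` are not edges, and
-- such a pair has one end coloured `b`, so at most `count b α + count b β` pairs are lost.
cut-mixed : ∀ (α β : Fin n → Bool) b →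
  count b α * count (not b) β + count (not b) α * count b β ≤ cut α β + (count b α + count b β)
cut-mixed {n} α β b = begin
  count b α * count (not b) β + count (not b) α * count b β
    ≡⟨ cong₂ _+_ (product b (not b)) (product (not b) b) ⟩
  sum (λ i → sum (λ j → α₌ b i * β₌ (not b) j)) + sum (λ i → sum (λ j → α₌ (not b) i * β₌ b j))
    ≡⟨ ∑-distrib-+ (λ i → sum (λ j → α₌ b i * β₌ (not b) j)) _ ⟨
  sum (λ i → sum (λ j → α₌ b i * β₌ (not b) j) + sum (λ j → α₌ (not b) i * β₌ b j))
    ≡⟨ sum-cong-≗ (λ i → trans (sym (∑-distrib-+ (λ j → α₌ b i * β₌ (not b) j) _))
                             (sum-cong-≗ λ j → xor (α i) (β j) b)) ⟩
  sum (λ i → sum (λ j → ⟦ α≢β? i j ⟧))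
    ≤⟨ sum-mono diagonal ⟩
  sum (λ i → sum (λ j → ⟦ differ? α β i j ⟧) + (α₌ b i + β₌ b i))
    ≡⟨ trans (∑-distrib-+ (λ i → sum (λ j → ⟦ differ? α β i j ⟧)) _)
             (cong (cut α β +_) (∑-distrib-+ (α₌ b) (β₌ b))) ⟩
  cut α β + (count b α + count b β) ∎
  where
  open ≤-Reasoning
  α₌ β₌ : Bool → Fin n → ℕ
  α₌ b i = ⟦ α i Bool.≟ b ⟧
  β₌ b i = ⟦ β i Bool.≟ b ⟧
  α≢β? : ∀ i j → Dec (α i ≢ β j)
  α≢β? i j = ¬? (α i Bool.≟ β j)
  product : ∀ b c → count b α * count c β ≡ sum (λ i → sum (λ j → α₌ b i * β₌ c j))
  product b c = trans (*-comm (count b α) (count c β))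
    (trans (*-distribˡ-sum (count c β) (α₌ b)) (sum-cong-≗ λ i →
      trans (*-comm (count c β) (α₌ b i)) (*-distribˡ-sum (α₌ b i) (β₌ c))))
  xor : ∀ x y b → ⟦ x Bool.≟ b ⟧ * ⟦ y Bool.≟ not b ⟧ + ⟦ x Bool.≟ not b ⟧ * ⟦ y Bool.≟ b ⟧
        ≡ ⟦ ¬? (x Bool.≟ y) ⟧
  xor true  true  true  = refl
  xor true  true  false = refl
  xor true  false true  = refl
  xor true  false false = refl
  xor false true  true  = refl
  xor false true  false = refl
  xor false false true  = refl
  xor false false false = refl
  either : ∀ x y b → ⟦ ¬? (x Bool.≟ y) ⟧ ≤ ⟦ x Bool.≟ b ⟧ + ⟦ y Bool.≟ b ⟧
  either true  true  _     = z≤n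
  either true  false true  = s≤s z≤n
  either true  false false = s≤s z≤n
  either false true  true  = s≤s z≤n
  either false true  false = s≤s z≤n
  either false false _     = z≤n
  diagonal : ∀ i → sum (λ j → ⟦ α≢β? i j ⟧) ≤ sum (λ j → ⟦ differ? α β i j ⟧) + (α₌ b i + β₌ b i)
  diagonal i = begin
    sum (λ j → ⟦ α≢β? i j ⟧)                                     ≤⟨ m≤m+n _ _ ⟩
    sum (λ j → ⟦ α≢β? i j ⟧) + ⟦ differ? α β i i ⟧
      ≤⟨ sum-mono-except₁ {f = λ j → ⟦ α≢β? i j ⟧} {λ j → ⟦ differ? α β i j ⟧} i
         (λ j j≢i → ⟦⟧-mono (α≢β? i j) (differ? α β i j) (j≢i ∘ sym ,_)) ⟩
    sum (λ j → ⟦ differ? α β i j ⟧) + ⟦ α≢β? i i ⟧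
      ≤⟨ +-monoʳ-≤ _ (either (α i) (β i) b) ⟩
    sum (λ j → ⟦ differ? α β i j ⟧) + (α₌ b i + β₌ b i)          ∎


-- The loss on the diagonal is estimated once for each colour; together the two estimates leave
-- equality only for a single vertex of a common colour in each fibre.
cut-extremal : 5 ≤ n → (α β : Fin n → Bool) → (∀ b → 1 ≤ count b α) → (∀ b → 1 ≤ count b β) →
  2 * (n ∸ 2) < cut α β ⊎ 2 * (n ∸ 2) ≤ cut α β × ∃ λ b → count b α ≡ 1 × count b β ≡ 1
cut-extremal 5≤n α β 1≤α 1≤β = result
  (cut-size {C = cut α β} 5≤n (1≤α true) (1≤α false) (1≤β true) (1≤β false)
            (count-total α true) (count-total β true)
            (cut-mixed α β true) (cut-mixed α β false))
  where
  result : _ ⊎ _ × _ → _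
  result (inj₁ big)                = inj₁ big
  result (inj₂ (bound , inj₁ one)) = inj₂ (bound , true , one)
  result (inj₂ (bound , inj₂ one)) = inj₂ (bound , false , one)

-- Cuts of G ⊗ K n

n-1<2[n-2] : 5 ≤ n → n ∸ 1 < 2 * (n ∸ 2)
n-1<2[n-2] (s≤s (s≤s (s≤s (s≤s (s≤s {n = k} z≤n))))) = subst (5 + k ≤_) (lem k) (m≤m+n (5 + k) (1 + k))
  where
  lem : ∀ k → 5 + k + (1 + k) ≡ 2 * (3 + k)
  lem = solve-∀

-- Contradicts `heavy-edge₂` when all `n` vertices of a fibre send `n ∸ 1` cut edges each to two
-- neighbouring fibres.
2[n-2]+n-1<[n-1]n : 5 ≤ n → 2 * (n ∸ 2) + (n ∸ 1) < (n ∸ 1) * n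
2[n-2]+n-1<[n-1]n (s≤s (s≤s (s≤s (s≤s (s≤s {n = k} z≤n))))) =
  subst (suc (2 * (3 + k) + (4 + k)) ≤_) (lem k) (m≤m+n _ (9 + 6 * k + k * k))
  where
  lem : ∀ k → suc (2 * (3 + k) + (4 + k)) + (9 + 6 * k + k * k) ≡ (4 + k) * (5 + k)
  lem = solve-∀

n-1<[n-1]² : 5 ≤ n → n ∸ 1 < (n ∸ 1) * (n ∸ 1)
n-1<[n-1]² (s≤s (s≤s (s≤s (s≤s (s≤s {n = k} z≤n))))) = m<m*n (4 + k) (4 + k) (s≤s (s≤s z≤n))

-- `X` describes a nonempty proper union of components of H - F: it is constant along surviving
-- edges and takes both values. The last hypothesis says that H - F has no isolated vertex.
module _ (G : Graph) {n ξ : ℕ} (5≤n : 5 ≤ n)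
         (ξ-min : ∀ u v → Graph.Adj G u v → ξ ≤ Graph.edgeDegree G u v)
         (F : EdgeSet (G ⊗ K n)) (∣F∣≤M : EdgeSet.∣ F ∣ ≤ (n ∸ 1) * ξ + 2 * (n ∸ 2))
         (X : Graph.V (G ⊗ K n) → Bool)
         (X-closed : ∀ {x y} → Graph.Adj (G ⊗ K n ─ F) x y → X x ≡ X y)
         (X-onto : ∀ b → ∃ λ x → X x ≡ b)
         (neighbour : ∀ x → ∃ (Graph.Adj (G ⊗ K n ─ F) x))
         where

  private
    H = G ⊗ K n
    c = n ∸ 1
    N = n ∸ 2
    M = c * ξ + 2 * N
    module G = FiniteGraph G
    module H = FiniteGraph H
    module F = EdgeSet F

  fibre : G.V → Fin n → Bool
  fibre p i = X (p , i)

  between : G.V → G.V → ℕ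
  between p q = sum (λ i → sum (λ j → ⟦ F.in? (p , i) (q , j) ⟧))

  between-sym : ∀ p q → between p q ≡ between q p
  between-sym p q = trans (∑-comm (λ i j → ⟦ F.in? (p , i) (q , j) ⟧)) (sum-cong-≗ λ i → sum-cong-≗ λ j →
    ⟦⟧-cong (F.in? (p , j) (q , i)) (F.in? (q , i) (p , j)) F.sym F.sym)

  between-irrefl : ∀ p → between p p ≡ 0
  between-irrefl p = trans
    (sum-cong-≗ λ i → trans
      (sum-cong-≗ λ j → ⟦⟧-no (F.in? (p , i) (p , j)) (λ f → G.irrefl refl (proj₁ (F.⊆Adj f))))
      K.Σᵥ-0)
    K.Σᵥ-0
    where module K = FiniteGraph (K n)

  cut≤between : ∀ {p q} → G.Adj p q → cut (fibre p) (fibre q) ≤ between p q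
  cut≤between {p} {q} p~q = sum-mono λ i → sum-mono λ j →
    ⟦⟧-mono (differ? (fibre p) (fibre q) i j) (F.in? (p , i) (q , j)) λ (i≢j , ne) →
      decidable-stable (F.in? (p , i) (q , j)) λ ∉F → ne (X-closed ((p~q , i≢j) , ∉F))

  row : G.V → ℕ
  row p = G.Σᵥ (between p)

  2*∣F∣≡Σrow : 2 * F.∣_∣ ≡ G.Σᵥ row
  2*∣F∣≡Σrow = begin
    2 * F.∣_∣                                                ≡⟨ H.2*∣∣≡Σᵥ F ⟩
    H.Σᵥ (λ x → H.Σᵥ (λ y → ⟦ F.in? x y ⟧))
      ≡⟨ Σᵥ-⊗ G (K n) (λ x → H.Σᵥ (λ y → ⟦ F.in? x y ⟧)) ⟩
    G.Σᵥ (λ p → sum (λ i → H.Σᵥ (λ y → ⟦ F.in? (p , i) y ⟧)))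
      ≡⟨ G.Σᵥ-cong (λ p → trans (sum-cong-≗ (λ i → Σᵥ-⊗ G (K n) (λ y → ⟦ F.in? (p , i) y ⟧)))
                                 (sym (G.Σᵥ-swap (λ q i → sum (λ j → ⟦ F.in? (p , i) (q , j) ⟧))))) ⟩
    G.Σᵥ row ∎
    where open ≡-Reasoning

  -- Inclusion-exclusion: the two rows count edges of `F` at the two fibres, and those between the
  -- fibres twice. In the symmetric matrix `between`, rows and columns `u` and `w` overlap in the
  -- corner entries.
  rows≤ : ∀ u w → u ≢ w → row u + row w ≤ F.∣_∣ + between u w
  rows≤ u w u≢w = *-cancelˡ-≤ 2 (begin
    2 * (row u + row w)                          ≡⟨ cong (row u + row w +_) (+-identityʳ _) ⟩
    (row u + row w) + (row u + row w)            ≡⟨ cong (_+ (row u + row w)) Σcol ⟨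
    G.Σᵥ col + (row u + row w)
      ≤⟨ G.Σᵥ-mono-except₂ {f = col} {row} u w u≢w (λ p _ _ → G.Σᵥ-pair {f = between p} u w u≢w) ⟩
    G.Σᵥ row + (col u + col w)                   ≡⟨ cong₂ _+_ (sym 2*∣F∣≡Σrow) corner ⟩
    2 * F.∣_∣ + 2 * between u w                  ≡⟨ *-distribˡ-+ 2 F.∣_∣ _ ⟨
    2 * (F.∣_∣ + between u w)                    ∎)
    where
    open ≤-Reasoning
    col : G.V → ℕ
    col p = between p u + between p w
    Σcol : G.Σᵥ col ≡ row u + row w
    Σcol = trans (G.Σᵥ-+ (λ p → between p u) (λ p → between p w))
      (cong₂ _+_ (G.Σᵥ-cong λ p → between-sym p u) (G.Σᵥ-cong λ p → between-sym p w))
    corner : col u + col w ≡ 2 * between u w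
    corner = cong₂ _+_ (cong (_+ between u w) (between-irrefl u))
                       (cong₂ _+_ (between-sym w u) (between-irrefl w))

  -- Mixed fibres are heavy, and so is a pure fibre next to a mixed one if no adjacent fibre is pure
  -- on its own side. The edge counts below serve both cases.
  Heavy : G.V → Set
  Heavy p = ∀ {q} → G.Adj p q → c ≤ between p q

  private
    weight : G.V → G.V → ℕ
    weight p q = c * ⟦ G.adj? p q ⟧

  weight≤ : ∀ {p} → Heavy p → ∀ q → weight p q ≤ between p q
  weight≤ {p} heavy q with G.adj? p q
  ... | yes p~q = ≤-trans (≤-reflexive (*-identityʳ c)) (heavy p~q)
  ... | no _    = ≤-trans (≤-reflexive (*-zeroʳ c)) z≤n

  weight≤c : ∀ p q → weight p q ≤ c
  weight≤c p q = ≤-trans (*-monoʳ-≤ c (⟦⟧-mono (G.adj? p q) (yes tt) λ _ → tt))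
                         (≤-reflexive (*-identityʳ c))

  Σweight : ∀ p → G.Σᵥ (weight p) ≡ c * G.degree p
  Σweight p = trans (G.Σᵥ-* c (λ q → ⟦ G.adj? p q ⟧)) (cong (c *_) (sym (G.degree-Σᵥ p)))

  -- Each neighbouring fibre contributes at least `c`; the surplus over `c` at one chosen fibre `q`
  -- is retained.
  row₁ : ∀ {p} → Heavy p → ∀ q → c * G.degree p + between p q ≤ row p + c
  row₁ {p} heavy q = begin
    c * G.degree p + between p q         ≡⟨ cong (_+ between p q) (Σweight p) ⟨
    G.Σᵥ (weight p) + between p q
      ≤⟨ G.Σᵥ-mono-except₁ {f = weight p} {between p} q (λ v _ → weight≤ heavy v) ⟩
    row p + weight p q                   ≤⟨ +-monoʳ-≤ (row p) (weight≤c p q) ⟩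
    row p + c                            ∎
    where open ≤-Reasoning

  row₂ : ∀ {p} → Heavy p → ∀ {q r} → q ≢ r →
         c * G.degree p + (between p q + between p r) ≤ row p + (c + c)
  row₂ {p} heavy {q} {r} q≢r = begin
    c * G.degree p + (between p q + between p r)
      ≡⟨ cong (_+ (between p q + between p r)) (Σweight p) ⟨
    G.Σᵥ (weight p) + (between p q + between p r)
      ≤⟨ G.Σᵥ-mono-except₂ {f = weight p} {between p} q r q≢r (λ v _ _ → weight≤ heavy v) ⟩
    row p + (weight p q + weight p r)
      ≤⟨ +-monoʳ-≤ (row p) (+-mono-≤ (weight≤c p q) (weight≤c p r)) ⟩
    row p + (c + c)                                      ∎
    where open ≤-Reasoning

  module _ {u w} (u~w : G.Adj u w) (heavy-u : Heavy u) (heavy-w : Heavy w) where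

    private
      u≢w : u ≢ w
      u≢w u≡w = G.irrefl u≡w u~w

      cξ≤ : c * (ξ + 2) ≤ c * (G.degree u + G.degree w)
      cξ≤ = *-monoʳ-≤ c (≤-trans (+-monoˡ-≤ 2 (ξ-min u w u~w)) (≤-reflexive (edgeDegree+2 G u~w)))

    -- With `e = between u w`, the two rows have at least `c (ξ + 2) + 2 (e - c)` entries, `e` of
    -- them repeated. Hence F has at least `c ξ + e` edges, but at most `c ξ + 2 N`.
    heavy-edge₁ : between u w ≤ 2 * N
    heavy-edge₁ = ≤-rearrange (c * (ξ + 2) + between u w) refl (lem ξ (between u w) c N) (begin
      c * (ξ + 2) + e + e                                     ≤⟨ +-monoˡ-≤ e (+-monoˡ-≤ e cξ≤) ⟩
      c * (G.degree u + G.degree w) + e + e                   ≡⟨ lem₁ c (G.degree u) _ e ⟩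
      (c * G.degree u + e) + (c * G.degree w + e)
        ≤⟨ +-mono-≤ (row₁ heavy-u w)
          (subst (λ x → c * G.degree w + x ≤ row w + c) (between-sym w u) (row₁ heavy-w u)) ⟩
      (row u + c) + (row w + c)                               ≡⟨ lem₂ (row u) _ c ⟩
      (row u + row w) + (c + c)                               ≤⟨ +-monoˡ-≤ (c + c) (rows≤ u w u≢w) ⟩
      F.∣_∣ + e + (c + c)
        ≤⟨ +-monoˡ-≤ (c + c) (+-monoˡ-≤ e ∣F∣≤M) ⟩
      M + e + (c + c)                                         ∎)
      where
      open ≤-Reasoning
      e = between u w
      lem : ∀ ξ e c N → c * ξ + 2 * N + e + (c + c) ≡ c * (ξ + 2) + e + 2 * N
      lem = solve-∀
      lem₁ : ∀ c d d′ e → c * (d + d′) + e + e ≡ (c * d + e) + (c * d′ + e)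
      lem₁ = solve-∀
      lem₂ : ∀ r r′ c → (r + c) + (r′ + c) ≡ (r + r′) + (c + c)
      lem₂ = solve-∀

    -- The same count, retaining also the surplus of `between u q` over `c`.
    heavy-edge₂ : ∀ {q} → w ≢ q → between u w + between u q ≤ 2 * N + c
    heavy-edge₂ {q} w≢q = ≤-rearrange (c * (ξ + 2) + e) refl (lem ξ e c N) (begin
      c * (ξ + 2) + e + (e + f)
        ≤⟨ +-monoˡ-≤ (e + f) (+-monoˡ-≤ e cξ≤) ⟩
      c * (G.degree u + G.degree w) + e + (e + f)                   ≡⟨ lem₁ c (G.degree u) _ e f ⟩
      (c * G.degree u + (e + f)) + (c * G.degree w + e)
        ≤⟨ +-mono-≤ (row₂ heavy-u w≢q)
          (subst (λ x → c * G.degree w + x ≤ row w + c) (between-sym w u) (row₁ heavy-w u)) ⟩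
      (row u + (c + c)) + (row w + c)                               ≡⟨ lem₂ (row u) _ c ⟩
      (row u + row w) + (c + c + c)
        ≤⟨ +-monoˡ-≤ (c + c + c) (rows≤ u w u≢w) ⟩
      F.∣_∣ + e + (c + c + c)
        ≤⟨ +-monoˡ-≤ (c + c + c) (+-monoˡ-≤ e ∣F∣≤M) ⟩
      M + e + (c + c + c)                                           ∎)
      where
      open ≤-Reasoning
      e = between u w
      f = between u q
      lem : ∀ ξ e c N → c * ξ + 2 * N + e + (c + c + c) ≡ c * (ξ + 2) + e + (2 * N + c)
      lem = solve-∀
      lem₁ : ∀ c d d′ e f → c * (d + d′) + e + (e + f) ≡ (c * d + (e + f)) + (c * d′ + e)
      lem₁ = solve-∀
      lem₂ : ∀ r r′ c → (r + (c + c)) + (r′ + c) ≡ (r + r′) + (c + c + c)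
      lem₂ = solve-∀

  -- Pure and mixed fibres

  Pure : Bool → G.V → Set
  Pure b p = ∀ i → X (p , i) ≡ b

  Mixed : G.V → Set
  Mixed p = ∀ b → ∃ λ i → X (p , i) ≡ b

  pure⊎mixed : ∀ p → (∃ λ b → Pure b p) ⊎ Mixed p
  pure⊎mixed p with any? (λ i → X (p , i) Bool.≟ true) | any? (λ i → X (p , i) Bool.≟ false)
  ... | no ∄t | _     = inj₁ (false , λ i → ¬-not (λ eq → ∄t (i , eq)))
  ... | yes _ | no ∄f = inj₁ (true , λ i → ¬-not (λ eq → ∄f (i , eq)))
  ... | yes t | yes f = inj₂ λ { true → t ; false → f }

  mixed⇒1≤count : ∀ {p} → Mixed p → ∀ b → 1 ≤ count b (fibre p)
  mixed⇒1≤count {p} mixed b = 1≤count {α = fibre p} (proj₁ (mixed b)) (proj₂ (mixed b))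

  between-pure : ∀ {p q b} → G.Adj p q → Pure b q → c * count (not b) (fibre p) ≤ between p q
  between-pure {p} {q} p~q pure = ≤-trans (cut-pure {α = fibre p} {fibre q} pure) (cut≤between p~q)

  between-pure-≥c : ∀ {p q b} → G.Adj p q → Pure b q → 1 ≤ count (not b) (fibre p) → c ≤ between p q
  between-pure-≥c {p} {q} {b} p~q pure 1≤ =
    ≤-trans (≤-reflexive (sym (*-identityʳ c))) (≤-trans (*-monoʳ-≤ c 1≤) (between-pure p~q pure))

  c<2N : c < 2 * N
  c<2N = n-1<2[n-2] 5≤n

  between-mixed : ∀ {p q} → G.Adj p q → Mixed p → Mixed q → 2 * N ≤ between p q
  between-mixed {p} {q} p~q mp mq
      with cut-extremal 5≤n (fibre p) (fibre q) (mixed⇒1≤count mp) (mixed⇒1≤count mq)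
  ... | inj₁ big         = ≤-trans (<⇒≤ big) (cut≤between p~q)
  ... | inj₂ (bound , _) = ≤-trans bound (cut≤between p~q)

  mixed⇒heavy : ∀ {p} → Mixed p → Heavy p
  mixed⇒heavy mp {q} p~q with pure⊎mixed q
  ... | inj₁ (b , pure) = between-pure-≥c p~q pure (mixed⇒1≤count mp (not b))
  ... | inj₂ mq         = ≤-trans (<⇒≤ c<2N) (between-mixed p~q mp mq)

  module _ (no-isolated-edge : ∀ {x y} → Graph.Adj (H ─ F) x y →
              (∀ {z} → Graph.Adj (H ─ F) x z → z ≡ y) →
              (∀ {z} → Graph.Adj (H ─ F) y z → z ≡ x) → ⊥) where

    -- The `2 N` edges towards `w` leave at most `c` for any other fibre `q`. A mixed `q` would take
    -- `2 N`; a pure `q` containing `z` is on side `b` and would take `c` edges from each of the `c`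
    -- other vertices over `u`.
    singletons⇒isolated : ∀ {u w b i j} → G.Adj u w → Mixed u → Mixed w →
      count b (fibre u) ≡ 1 → count b (fibre w) ≡ 1 → X (u , i) ≡ b → X (w , j) ≡ b →
      ∀ {z} → Graph.Adj (H ─ F) (u , i) z → z ≡ (w , j)
    singletons⇒isolated {u} {w} {b} {i} {j} u~w mu mw u₁ w₁ Xui Xwj {q , l} adj
      with q G.≟ w
    ... | yes refl = cong (q ,_) (count≡1⇒unique w₁ (trans (sym (X-closed adj)) Xui) Xwj)
    ... | no q≢w = ⊥-elim (light (pure⊎mixed q))
      where
      u~q = proj₁ (proj₁ adj)
      between≤c : between u q ≤ c
      between≤c = +-cancelˡ-≤ (2 * N) _ _
        (≤-trans (+-monoˡ-≤ (between u q) (between-mixed u~w mu mw))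
                 (heavy-edge₂ u~w (mixed⇒heavy mu) (mixed⇒heavy mw) (q≢w ∘ sym)))
      rest : count (not b) (fibre u) ≡ c
      rest = cong (_∸ 1) (trans (cong (_+ count (not b) (fibre u)) (sym u₁)) (count-total (fibre u) b))
      light : (∃ λ b → Pure b q) ⊎ Mixed q → ⊥
      light (inj₂ mq) = <⇒≱ c<2N (≤-trans (between-mixed u~q mu mq) between≤c)
      light (inj₁ (b′ , pure)) = <⇒≱ (n-1<[n-1]² 5≤n)
        (≤-trans (subst (λ d → c * d ≤ between u q) rest (between-pure u~q pure-b)) between≤c)
        where
        pure-b : Pure b q
        pure-b l′ = trans (pure l′) (trans (sym (pure l)) (trans (sym (X-closed adj)) Xui))

    mixed-independent : ∀ {u w} → G.Adj u w → Mixed u → Mixed w → ⊥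
    mixed-independent {u} {w} u~w mu mw
      with cut-extremal 5≤n (fibre u) (fibre w) (mixed⇒1≤count mu) (mixed⇒1≤count mw)
    ... | inj₁ big = <⇒≱ big (≤-trans (cut≤between u~w) (heavy-edge₁ u~w (mixed⇒heavy mu) (mixed⇒heavy mw)))
    ... | inj₂ (_ , b , u₁ , w₁) =
      let (i , Xui) = mu b
          (j , Xwj) = mw b
          only = singletons⇒isolated u~w mu mw u₁ w₁ Xui Xwj
          -- That the two single vertices are joined in H - F follows because the first has some
          -- surviving edge and `only` identifies its other end.
          (z , adj) = neighbour (u , i)
      in no-isolated-edge (subst (Graph.Adj (H ─ F) (u , i)) (only adj) adj) only
           (singletons⇒isolated (G.Adj-sym u~w) mw mu w₁ u₁ Xwj Xui)

    -- If there is none, `w` is heavy. A surviving edge from a vertex over `u` off side `b` ends in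
    -- a fibre `q`, which is pure on the opposite side to `w`; the edges from `u` to `w` and `q` are
    -- then too many.
    monochromatic-neighbour : ∀ {u w b} → G.Adj u w → Mixed u → Pure b w →
                              ∃ λ q → G.Adj w q × Pure b q
    monochromatic-neighbour {u} {w} {b} u~w mu pure-w
      with G.anyᵥ? (λ q → G.adj? w q ×-dec all? (λ i → X (q , i) Bool.≟ b))
    ... | yes found = found
    ... | no  none  = ⊥-elim contra
      where
      i = proj₁ (mu (not b))
      heavy-w : Heavy w
      heavy-w {q} w~q = subst (c ≤_) (between-sym q w)
        (between-pure-≥c (G.Adj-sym w~q) pure-w (1≤ (pure⊎mixed q)))
        where
        1≤ : (∃ λ b → Pure b q) ⊎ Mixed q → 1 ≤ count (not b) (fibre q)
        1≤ (inj₂ mq) = mixed⇒1≤count mq (not b)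
        1≤ (inj₁ (b′ , pure)) = 1≤count {α = fibre q} i (¬-not λ eq →
          none (q , w~q , λ l → trans (pure l) (trans (sym (pure i)) eq)))
      q = proj₁ (proj₁ (neighbour (u , i)))
      j = proj₂ (proj₁ (neighbour (u , i)))
      adj = proj₂ (neighbour (u , i))
      u~q = proj₁ (proj₁ adj)
      Xqj : X (q , j) ≡ not b
      Xqj = trans (sym (X-closed adj)) (proj₂ (mu (not b)))
      pure-q : Pure (not b) q
      pure-q with pure⊎mixed q
      ... | inj₁ (_ , pure) = λ l → trans (pure l) (trans (sym (pure j)) Xqj)
      ... | inj₂ mq         = ⊥-elim (mixed-independent u~q mu mq)
      w≢q : w ≢ q
      w≢q w≡q = not-¬ (pure-w j) (trans (cong (λ v → X (v , j)) w≡q) Xqj)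
      contra : ⊥
      -- Each of the `n` vertices over `u` sends `c` cut edges to whichever of the fibres of `w` and
      -- `q` lies on the other side.
      contra = <⇒≱ (2[n-2]+n-1<[n-1]n 5≤n) (begin
        c * n
          ≡⟨ cong (c *_) (count-total (fibre u) (not b)) ⟨
        c * (count (not b) (fibre u) + count (not (not b)) (fibre u))
          ≡⟨ *-distribˡ-+ c (count (not b) (fibre u)) _ ⟩
        c * count (not b) (fibre u) + c * count (not (not b)) (fibre u)
          ≤⟨ +-mono-≤ (between-pure u~w pure-w) (between-pure u~q pure-q) ⟩
        between u w + between u q
          ≤⟨ heavy-edge₂ u~w (mixed⇒heavy mu) heavy-w w≢q ⟩
        2 * N + c                                               ∎)
        where open ≤-Reasoning

    -- The cuts of G given by the slices of X

    slice : Fin n → EdgeSet G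
    slice i = ∂ G (λ p → X (p , i))

    -- A pure fibre looks the same in every slice, and a mixed fibre has only pure neighbours, so
    -- sides and surviving edges carry over to slice `i`. When the surviving edge at a pure fibre
    -- ends in a mixed one, `monochromatic-neighbour` replaces it.
    slice-restricted : ∀ i → IsRestrictedEdgeCut G (slice i)
    slice-restricted i = ∂-restricted G (λ p → X (p , i)) (onto true) (onto false) nb
      where
      constant : ∀ {b p} → Pure b p → ∀ l → X (p , i) ≡ X (p , l)
      constant pure l = trans (pure i) (sym (pure l))
      onto : ∀ b → ∃ λ p → X (p , i) ≡ b
      onto b with X-onto b
      ... | (p , j) , Xpj with pure⊎mixed p
      ...   | inj₁ (_ , pure) = p , trans (constant pure j) Xpj
      ...   | inj₂ mp with neighbour (p , j)
      ...     | (q , l) , adj with pure⊎mixed q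
      ...       | inj₁ (_ , pure) = q , trans (constant pure l) (trans (sym (X-closed adj)) Xpj)
      ...       | inj₂ mq         = ⊥-elim (mixed-independent (proj₁ (proj₁ adj)) mp mq)
      nb : ∀ p → ∃ λ q → G.Adj p q × X (p , i) ≡ X (q , i)
      nb p with neighbour (p , i)
      ... | (q , l) , adj with pure⊎mixed q
      ...   | inj₁ (_ , pure) = q , proj₁ (proj₁ adj) , trans (X-closed adj) (sym (constant pure l))
      ...   | inj₂ mq with pure⊎mixed p
      ...     | inj₂ mp = ⊥-elim (mixed-independent (proj₁ (proj₁ adj)) mp mq)
      ...     | inj₁ (b , pure) with monochromatic-neighbour (G.Adj-sym (proj₁ (proj₁ adj))) mq pure
      ...       | r , p~r , pure-r = r , p~r , trans (pure i) (sym (pure-r i))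

    in-slice : G.V → G.V → Fin n → ℕ
    in-slice p q i = ⟦ EdgeSet.in? (slice i) p q ⟧

    -- If `p q` lies in slice `i`, then `(p , i)` is opposite to the pure fibre of `q` and sends `c`
    -- edges of `F` to it.
    in-slices-pure : ∀ {p q b} → G.Adj p q → Pure b q → c * sum (in-slice p q) ≤ between p q
    in-slices-pure {p} {q} {b} p~q pure = ≤-trans
      (*-monoʳ-≤ c (sum-mono λ i → ⟦⟧-mono (EdgeSet.in? (slice i) p q) (X (p , i) Bool.≟ not b)
        λ (_ , ne) → ¬-not (λ eq → ne (trans eq (sym (pure i))))))
      (between-pure p~q pure)

    in-slices : ∀ p q → c * sum (in-slice p q) ≤ between p q
    in-slices p q = go (G.adj? p q) (pure⊎mixed p) (pure⊎mixed q)
      where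
      go : Dec (G.Adj p q) → (∃ λ b → Pure b p) ⊎ Mixed p → (∃ λ b → Pure b q) ⊎ Mixed q →
           c * sum (in-slice p q) ≤ between p q
      go (no p≁q) _ _ = ≤-trans (≤-reflexive (trans (cong (c *_) (trans
        (sum-cong-≗ λ i → ⟦⟧-no (EdgeSet.in? (slice i) p q) (p≁q ∘ proj₁)) (FiniteGraph.Σᵥ-0 (K n)))) (*-zeroʳ c))) z≤n
      go (yes p~q) _ (inj₁ (_ , pure)) = in-slices-pure p~q pure
      go (yes p~q) (inj₁ (_ , pure)) (inj₂ _) = subst₂ (λ x y → c * x ≤ y)
        (sum-cong-≗ λ i → ⟦⟧-cong (EdgeSet.in? (slice i) q p) (EdgeSet.in? (slice i) p q)
          (EdgeSet.sym (slice i) {q} {p}) (EdgeSet.sym (slice i) {p} {q}))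
        (between-sym q p) (in-slices-pure (G.Adj-sym p~q) pure)
      go (yes p~q) (inj₂ mp) (inj₂ mq) = ⊥-elim (mixed-independent p~q mp mq)

    Σslices≤∣F∣ : c * sum (λ i → EdgeSet.∣ slice i ∣) ≤ F.∣_∣
    Σslices≤∣F∣ = *-cancelˡ-≤ 2 (begin
      2 * (c * sum (λ i → EdgeSet.∣ slice i ∣))
        ≡⟨ trans (lem c _) (cong (c *_) (*-distribˡ-sum 2 (λ i → EdgeSet.∣ slice i ∣))) ⟩
      c * sum (λ i → 2 * EdgeSet.∣ slice i ∣)
        ≡⟨ cong (c *_) (sum-cong-≗ λ i → G.2*∣∣≡Σᵥ (slice i)) ⟩
      c * sum (λ i → G.Σᵥ (λ p → G.Σᵥ (λ q → in-slice p q i)))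
        ≡⟨ cong (c *_) (G.Σᵥ-swap (λ p i → G.Σᵥ (λ q → in-slice p q i))) ⟨
      c * G.Σᵥ (λ p → sum (λ i → G.Σᵥ (λ q → in-slice p q i)))
        ≡⟨ G.Σᵥ-* c (λ p → sum (λ i → G.Σᵥ (λ q → in-slice p q i))) ⟨
      G.Σᵥ (λ p → c * sum (λ i → G.Σᵥ (λ q → in-slice p q i)))
        ≡⟨ G.Σᵥ-cong (λ p → trans (cong (c *_) (sym (G.Σᵥ-swap (in-slice p))))
                                 (sym (G.Σᵥ-* c (λ q → sum (in-slice p q))))) ⟩
      G.Σᵥ (λ p → G.Σᵥ (λ q → c * sum (in-slice p q)))
        ≤⟨ G.Σᵥ-mono (λ p → G.Σᵥ-mono (in-slices p)) ⟩
      G.Σᵥ row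
        ≡⟨ 2*∣F∣≡Σrow ⟨
      2 * F.∣_∣ ∎)
      where
      open ≤-Reasoning
      lem : ∀ c s → 2 * (c * s) ≡ c * (2 * s)
      lem = solve-∀

    -- Averaging over the `n` slices would give `n (M + 1) ≤ n M`.
    slices-not-heavy : (∀ D → IsRestrictedEdgeCut G D → M < n * c * EdgeSet.∣ D ∣) → ⊥
    slices-not-heavy heavy = <⇒≱ (n<1+n M) (*-cancelˡ-≤ n {{>-nonZero (≤-trans (s≤s z≤n) 5≤n)}} (begin
      n * suc M                                    ≡⟨ sum-const n (suc M) ⟨
      sum {n} (λ _ → suc M)
        ≤⟨ sum-mono (λ i → heavy (slice i) (slice-restricted i)) ⟩
      sum (λ i → n * c * EdgeSet.∣ slice i ∣)
        ≡⟨ *-distribˡ-sum (n * c) (λ i → EdgeSet.∣ slice i ∣) ⟨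
      n * c * sum (λ i → EdgeSet.∣ slice i ∣)      ≡⟨ *-assoc n c _ ⟩
      n * (c * sum (λ i → EdgeSet.∣ slice i ∣))    ≤⟨ *-monoʳ-≤ n (≤-trans Σslices≤∣F∣ ∣F∣≤M) ⟩
      n * M                                        ∎))
      where open ≤-Reasoning

-- Components

-- Double negation shift, constructive over a finite index set; it allows all reachability questions
-- to be taken as decided at once.
¬¬-∀Fin : ∀ {P : Fin n → Set} → (∀ i → ¬ ¬ P i) → ¬ ¬ (∀ i → P i)
¬¬-∀Fin {zero}  _  k = k λ ()
¬¬-∀Fin {suc n} ¬¬P k = ¬¬P zero λ p → ¬¬-∀Fin (¬¬P ∘ suc) λ ps → k λ { zero → p ; (suc i) → ps i }

module _ (H : Graph) where

  open FiniteGraph H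

  ¬¬-∀V : ∀ {P : V → Set} → (∀ v → ¬ ¬ P v) → ¬ ¬ (∀ v → P v)
  ¬¬-∀V {P} ¬¬P k = ¬¬-∀Fin (¬¬P ∘ vertex) λ ps → k λ v → subst P (vertex-index v) (ps (index v))

  module _ (F : EdgeSet H) where

    private
      _∼_ = Graph.Adj (H ─ F)
      _∼?_ = Graph.adj? (H ─ F)

    -- Isolation expressed through neighbours rather than walks, hence decidable.
    IsolatedEdge : V → V → Set
    IsolatedEdge x y = x ∼ y × (∀ z → x ∼ z → z ≡ y) × (∀ z → y ∼ z → z ≡ x)

    isolatedEdge? : ∀ x y → Dec (IsolatedEdge x y)
    isolatedEdge? x y =
      (x ∼? y)
      ×-dec allᵥ? (λ z → (x ∼? z) →-dec (z ≟ y))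
      ×-dec allᵥ? (λ z → (y ∼? z) →-dec (z ≟ x))

    isolatedEdge⇒isolatesEdge : ∀ {x y} → IsolatedEdge x y → IsolatesEdge H F
    isolatedEdge⇒isolatesEdge {x} {y} (x∼y , onlyx , onlyy) = x , x , y , x∼y , reach , back
      where
      -- A walk can only alternate between `x` and `y`.
      reach : ∀ {z} → Star _∼_ x z → x ≡ z ⊎ y ≡ z
      reachʸ : ∀ {z} → Star _∼_ y z → x ≡ z ⊎ y ≡ z
      reach ε = inj₁ refl
      reach (a ◅ as) rewrite onlyx _ a = reachʸ as
      reachʸ ε = inj₂ refl
      reachʸ (a ◅ as) rewrite onlyy _ a = reach as
      back : ∀ {z} → x ≡ z ⊎ y ≡ z → Star _∼_ x z
      back (inj₁ refl) = ε
      back (inj₂ refl) = x∼y ◅ ε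

    -- Of two distinct vertices in the component of `r` one differs from `r`, and the walk to it has
    -- a first edge.
    restricted⇒neighbour : IsRestrictedEdgeCut H F → ∀ r → ∃ (r ∼_)
    restricted⇒neighbour (_ , components) r with components r
    ... | u , v , ε , ε , u≢v = contradiction refl u≢v
    ... | u , v , (a ◅ _) , _ , _ = _ , a
    ... | u , v , ε , (a ◅ _) , _ = _ , a

    -- The double negation replaces a decision procedure for reachability; it is harmless, as the
    -- existence of an isolated edge is decidable.
    ¬¬-separation : IsEdgeCut H F →
      ¬ ¬ (∃ λ (X : V → Bool) → (∀ {x y} → x ∼ y → X x ≡ X y) × (∀ b → ∃ λ x → X x ≡ b))
    ¬¬-separation disconnected none =
      ¬¬-∀V (λ u → ¬¬-∀V {P = λ v → Dec (Star _∼_ u v)} (λ v → ¬¬-excluded-middle)) λ reach? →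
        disconnected λ u v → decidable-stable (reach? u v) λ u≁v → none
          -- The separating set is the component of `u`, which misses `v`.
          ( (λ w → does (reach? u w))
          , (λ {x} {y} x∼y → closed (reach? u) x∼y)
          , λ { true → u , dec-true (reach? u u) ε ; false → v , dec-false (reach? u v) u≁v })
      where
      closed : ∀ {u} (reach? : ∀ v → Dec (Star _∼_ u v)) {x y} → x ∼ y → does (reach? x) ≡ does (reach? y)
      closed reach? {x} {y} x∼y with reach? x | reach? y
      ... | yes _  | yes _  = refl
      ... | no _   | no _   = refl
      ... | yes ux | no ¬uy = contradiction (ux ◅◅ x∼y ◅ ε) ¬uy
      ... | no ¬ux | yes uy = contradiction (uy ◅◅ Graph.sym (H ─ F) x∼y ◅ ε) ¬ux

-- Super restricted edge-connectivity of the product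

theorem3p1 : (G : Graph) → Graph.Nontrivial G → Graph.Connected G →
    (n : ℕ) → 5 ≤ n →
    (ξ : ℕ) → Isξ G ξ →
    (λ′ : ℕ ⁺) → Isλ′ G λ′ →
    [ (n ∸ 1) * ξ + 2 * (n ∸ 2) ] <⁺ (n * (n ∸ 1)) *⁺ λ′ →
    Superλ′ (G ⊗ K n)
theorem3p1 G nontrivial connected n 5≤n ξ isξ λ′ isλ′ M<λ′ F (restricted , minimal)
  with H.anyᵥ? (λ x → H.anyᵥ? (λ y → isolatedEdge? (G ⊗ K n) F x y))
  where module H = FiniteGraph (G ⊗ K n)
... | yes (_ , _ , isolated) = isolatedEdge⇒isolatesEdge (G ⊗ K n) F isolated
... | no none = ⊥-elim (¬¬-separation H F (proj₁ restricted) λ (X , X-closed , X-onto) →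
    slices-not-heavy G 5≤n (proj₂ isξ) F ∣F∣≤M X X-closed X-onto (restricted⇒neighbour H F restricted)
      (λ {x} {y} x∼y onlyx onlyy → none (x , y , x∼y , (λ _ → onlyx) , λ _ → onlyy))
      (λ D cut → heavy λ′ isλ′ M<λ′ D cut))
  where
  H = G ⊗ K n
  ∣F∣≤M : EdgeSet.∣ F ∣ ≤ (n ∸ 1) * ξ + 2 * (n ∸ 2)
  ∣F∣≤M = let (F′ , restricted′ , ∣F′∣≤M) = restrictedCut-ξ G nontrivial connected 5≤n isξ
          in ≤-trans (minimal F′ restricted′) ∣F′∣≤M
  heavy : ∀ λ′ → Isλ′ G λ′ → [ (n ∸ 1) * ξ + 2 * (n ∸ 2) ] <⁺ (n * (n ∸ 1)) *⁺ λ′ →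
          ∀ D → IsRestrictedEdgeCut G D → (n ∸ 1) * ξ + 2 * (n ∸ 2) < n * (n ∸ 1) * EdgeSet.∣ D ∣
  -- An infinite λ′ means that `G` has no restricted edge-cut, so there is no `D` to bound.
  heavy ⊤⁺    none                          _      D cut = contradiction cut (none D)
  heavy [ l ] (_ , (_ , smallest) , refl) M<l D cut = ≤-trans ([<]-injective M<l)
    (*-monoʳ-≤ (n * (n ∸ 1)) (smallest D cut))
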